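{- For every integer $n\ge1$, let $\mathrm{Peak}_{\mathcal N_2(n)}(t)=\sum t^{\mathrm{peak}(\mathbf a)}$, the sum being over all area sequences $\mathbf a$ of size $n$ with $\mathrm{pnest}(\mathbf a)\le2$, and let $\gamma_{\mathcal N_2(n)}(t)$ be the gamma-polynomial of the symmetric polynomial $\mathrm{Peak}_{\mathcal N_2(n)}(t)/t$. Then $$\gamma_{\mathcal N_2(n)}(t)=\sum_{i=0}^{\lfloor\frac{n-1}{2}\rfloor}\binom{n-1}{2i}t^i=\frac{(1+\sqrt t)^{n-1}+(1-\sqrt t)^{n-1}}{2}.$$ Moreover, $\binom{n-1}{2i}$ is the number of Motzkin paths of length $n-1$ with $i$ $U$ steps and height at most $1$ (equivalently, the number of Motzkin sequences of size $n$ with $i$ ascents whose largest entry is at most $2$).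
   Context: Write $[n]=\{1,\dots,n\}$. An area sequence of size $n$ is a sequence $\mathbf a=(a_1,\dots,a_n)$ of nonnegative integers with $a_i<i$ for all $i$ and $a_i\le a_{i-1}+1$ for all $i\ge 2$. It defines a graph $\Gamma_{\mathbf a}$ (a unit interval graph) on $[n]$ with edges $\{j,i\}$ for $1\le j<i\le n$ with $i-a_i\le j$. If $\{i,j\}$ with $i<j$ is an edge then $\{i,i+1,\dots,j\}$ is a clique. A peak-edge of $\Gamma_{\mathbf a}$ is either an isolated vertex $i$ (put $j=i$) or an edge $\{i,j\}$, $i<j$, such that neither $\{i,j+1\}$ nor $\{i-1,j\}$ is an edge (pairs not contained in $[n]$ are not edges). The corresponding peak-clique is $\{i,\dots,j\}$. The number of peak-edges is $\mathrm{peak}(\mathbf a)$. The peak-nesting of a vertex is the number of peak-cliques containing it, and $\mathrm{pnest}(\mathbf a)$ is the maximum over all vertices. A polynomial $p(t)$ of degree $d$ is symmetric if $p(t)=t^dp(1/t)$; then $p(t)=\sum_{0\le 2i\le d}\gamma_it^i(1+t)^{d-2i}$ uniquely and $\gamma_p(t)=\sum_i\gamma_it^i$ is its gamma-polynomial. A Motzkin path of length $m$ is a lattice path from $(0,0)$ to $(m,0)$ with steps $U=(1,1)$, $D=(1,-1)$, $H=(1,0)$ never going below the $x$-axis; its height is the largest $y$-coordinate attained. A Motzkin sequence of size $n$ is a sequence $(w_1,\dots,w_n)$ of positive integers with $w_1=w_n=1$ and $|w_i-w_{i+1}|\le1$; an ascent is an index $i\in[n-1]$ with $w_i<w_{i+1}$.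 -}

module Defs where

open import Algebra.Bundles using (CommutativeRing; RawRing)
import Algebra.Definitions.RawSemiring as RawSemiringDefinitions
open import Data.Fin.Base using (Fin; toℕ)
import Data.Fin.Base as Fin
import Data.Fin.Properties as Fin
import Data.Integer.Base as ℤ
import Data.Integer.Properties as ℤ
open import Data.List.Base
  using (List; []; _∷_; map; foldr; filter; length; upTo; allFin; cartesianProduct; cartesianProductWith)
open import Data.List.Extrema.Nat using (max)
open import Data.List.Membership.Propositional using (_∈_)
open import Data.List.Membership.Propositional.Properties
  using (∈-cartesianProductWith⁺; ∈-filter⁺; ∈-upTo⁺)
open import Data.List.Relation.Unary.Any using (here)
open import Data.List.Relation.Unary.Unique.Propositional using (Unique)
import Data.List.Relation.Unary.Unique.Propositional.Properties as Unique
import Data.List.Relation.Unary.All as ListAll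
import Data.List.Relation.Unary.AllPairs as AllPairs
open import Data.Nat.Base using (ℕ; zero; suc; _∸_; _≤_; _<_; ∣_-_∣; ⌊_/2⌋; s≤s)
import Data.Nat.Base as ℕ
import Data.Nat.Properties as ℕ
open import Data.Nat.Combinatorics using (_C_)
open import Data.Product.Base using (_×_; _,_; ∃-syntax)
import Data.Rational.Properties as ℚ
open import Data.Sum.Base using (_⊎_)
open import Data.Vec.Base using (Vec; []; _∷_; lookup; last; count; toList; foldr′)
open import Data.Vec.Properties using (∷-injective)
open import Data.Vec.Relation.Unary.All using (All; []; _∷_)
import Data.Vec.Relation.Unary.All as All
open import Data.Vec.Relation.Unary.All.Properties using (lookup⁻)
open import Level using (Level)
open import Relation.Binary.Definitions using (DecidableEquality)
open import Relation.Binary.PropositionalEquality using (_≡_; refl; sym; subst)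
open import Relation.Nullary using (¬_; Dec; yes; no)
open import Relation.Nullary.Decidable using (_×-dec_; _⊎-dec_; _→-dec_; ¬?)

-- A polynomial is the list of its coefficients, lowest degree first; trailing
-- zeros are allowed, so equality of polynomials is the coefficientwise _≈ᵖ_.

module Polynomial {c ℓ : Level} (R : CommutativeRing c ℓ) where

  open CommutativeRing R
    using (Carrier; _≈_; _≉_; _+_; _*_; -_; 0#; 1#)

  Poly : Set c
  Poly = List Carrier

  coeff : Poly → ℕ → Carrier
  coeff []      k       = 0#
  coeff (x ∷ p) zero    = x
  coeff (x ∷ p) (suc k) = coeff p k

  infix 4 _≈ᵖ_
  _≈ᵖ_ : Poly → Poly → Set ℓ
  p ≈ᵖ q = ∀ k → coeff p k ≈ coeff q k

  infixl 6 _+ᵖ_ _-ᵖ_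
  infixl 7 _·_ _*ᵖ_

  _+ᵖ_ : Poly → Poly → Poly
  []      +ᵖ q       = q
  (x ∷ p) +ᵖ []      = x ∷ p
  (x ∷ p) +ᵖ (y ∷ q) = (x + y) ∷ (p +ᵖ q)

  _·_ : Carrier → Poly → Poly
  x · p = map (x *_) p

  _*ᵖ_ : Poly → Poly → Poly
  []      *ᵖ q = []
  (x ∷ p) *ᵖ q = x · q +ᵖ (0# ∷ p *ᵖ q)

  0ᵖ 1ᵖ X : Poly
  0ᵖ = []
  1ᵖ = 1# ∷ []
  X  = 0# ∷ 1# ∷ []

  polynomialRawRing : RawRing c ℓ
  polynomialRawRing = record
    { Carrier = Poly
    ; _≈_     = _≈ᵖ_
    ; _+_     = _+ᵖ_
    ; _*_     = _*ᵖ_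
    ; -_      = map -_
    ; 0#      = 0ᵖ
    ; 1#      = 1ᵖ
    }

  open RawSemiringDefinitions (RawRing.rawSemiring polynomialRawRing) public
    using (_^_) renaming (_×_ to _×ᵖ_)

  _-ᵖ_ : Poly → Poly → Poly
  p -ᵖ q = p +ᵖ map -_ q

  -- Substitution p(q), by Horner's rule.
  _⟨_⟩ : Poly → Poly → Poly
  []      ⟨ q ⟩ = 0ᵖ
  (x ∷ p) ⟨ q ⟩ = (x ∷ []) +ᵖ q *ᵖ (p ⟨ q ⟩)

  ∑ : {a : Level} {A : Set a} → List A → (A → Poly) → Poly
  ∑ xs f = foldr _+ᵖ_ 0ᵖ (map f xs)

  infix 5 ∑
  syntax ∑ xs (λ x → e) = ∑[ x ∈ xs ] e

  HasDegree : Poly → ℕ → Set ℓ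
  HasDegree p d = coeff p d ≉ 0# × (∀ k → d < k → coeff p k ≈ 0#)

  -- t^d p(1/t), for a polynomial p of degree at most d.
  reciprocal : ℕ → Poly → Poly
  reciprocal d p = ∑[ k ∈ upTo (suc d) ] coeff p k · X ^ (d ∸ k)

  gammaExpansion : ℕ → Poly → Poly
  gammaExpansion d γ =
    ∑[ i ∈ upTo (suc ⌊ d /2⌋) ] coeff γ i · (X ^ i *ᵖ (1ᵖ +ᵖ X) ^ (d ∸ 2 ℕ.* i))

  -- The condition on the coefficients of γ beyond ⌊d/2⌋, which do not occur
  -- in the expansion, makes γ unique up to _≈ᵖ_.
  IsGammaPolynomial : Poly → Poly → Set ℓ
  IsGammaPolynomial p γ = ∃[ d ]
      HasDegree p d
    × p ≈ᵖ reciprocal d p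
    × p ≈ᵖ gammaExpansion d γ
    × (∀ i → ⌊ d /2⌋ < i → coeff γ i ≈ 0#)

open Polynomial ℚ.+-*-commutativeRing public

private
  variable
    a : Level
    A : Set a
    n : ℕ

vectors : (n : ℕ) → List A → List (Vec A n)
vectors zero    xs = [] ∷ []
vectors (suc n) xs = cartesianProductWith _∷_ xs (vectors n xs)

vectors-unique : ∀ n {xs : List A} → Unique xs → Unique (vectors n xs)
vectors-unique zero    xs! = ListAll.[] AllPairs.∷ AllPairs.[]
vectors-unique (suc n) xs! =
  Unique.cartesianProductWith⁺ _∷_ ∷-injective xs! (vectors-unique n xs!)

vectors-complete : {xs : List A} {v : Vec A n} → All (_∈ xs) v → v ∈ vectors n xs
vectors-complete []         = here refl
vectors-complete (px ∷ pxs) = ∈-cartesianProductWith⁺ _∷_ px (vectors-complete pxs)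

-- Positions and vertices are the elements of Fin n: position k of the
-- 1-based convention is the i with suc (toℕ i) ≡ k.

IsAreaSequence : Vec ℕ n → Set
IsAreaSequence {n} a =
    (∀ i → lookup a i < suc (toℕ i))
  × (∀ (i j : Fin n) → toℕ j ≡ suc (toℕ i) → lookup a j ≤ suc (lookup a i))

isAreaSequence? : (a : Vec ℕ n) → Dec (IsAreaSequence a)
isAreaSequence? a =
  Fin.all? (λ i → lookup a i ℕ.<? suc (toℕ i))
  ×-dec Fin.all? (λ i → Fin.all? (λ j →
    (toℕ j ℕ.≟ suc (toℕ i)) →-dec (lookup a j ℕ.≤? suc (lookup a i))))

areaSequences : (n : ℕ) → List (Vec ℕ n)
areaSequences n = filter isAreaSequence? (vectors n (upTo n))

areaSequences-unique : ∀ n → Unique (areaSequences n)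
areaSequences-unique n =
  Unique.filter⁺ isAreaSequence? (vectors-unique n (Unique.upTo⁺ n))

areaSequences-complete : {a : Vec ℕ n} → IsAreaSequence a → a ∈ areaSequences n
areaSequences-complete isArea@(a< , _) =
  ∈-filter⁺ isAreaSequence?
    (vectors-complete (lookup⁻ λ i → ∈-upTo⁺ (ℕ.<-≤-trans (a< i) (Fin.toℕ<n i))))
    isArea

-- For j < i: since lookup a i ≤ toℕ i, the subtraction is not truncated, and
-- the shift from 1-based to 0-based positions cancels.
Arc : Vec ℕ n → Fin n → Fin n → Set
Arc a j i = j Fin.< i × toℕ i ∸ lookup a i ≤ toℕ j

Adjacent : Vec ℕ n → Fin n → Fin n → Set
Adjacent a u v = Arc a u v ⊎ Arc a v u

Isolated : Vec ℕ n → Fin n → Set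
Isolated a i = ∀ k → ¬ Adjacent a i k

-- The pair i ≤ j stands for the peak-edge {i,j}, or for the isolated vertex i
-- when i = j.
IsPeakEdge : Vec ℕ n → Fin n × Fin n → Set
IsPeakEdge a (i , j) =
    (i ≡ j × Isolated a i)
  ⊎ (i Fin.< j
    × Adjacent a i j
    × (∀ k → toℕ k ≡ suc (toℕ j) → ¬ Adjacent a i k)
    × (∀ k → toℕ i ≡ suc (toℕ k) → ¬ Adjacent a k j))

arc? : (a : Vec ℕ n) (j i : Fin n) → Dec (Arc a j i)
arc? a j i = (j Fin.<? i) ×-dec (toℕ i ∸ lookup a i ℕ.≤? toℕ j)

adjacent? : (a : Vec ℕ n) (u v : Fin n) → Dec (Adjacent a u v)
adjacent? a u v = arc? a u v ⊎-dec arc? a v u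

isPeakEdge? : (a : Vec ℕ n) (e : Fin n × Fin n) → Dec (IsPeakEdge a e)
isPeakEdge? a (i , j) =
  ((i Fin.≟ j) ×-dec Fin.all? (λ k → ¬? (adjacent? a i k)))
  ⊎-dec ((i Fin.<? j)
    ×-dec adjacent? a i j
    ×-dec Fin.all? (λ k → (toℕ k ℕ.≟ suc (toℕ j)) →-dec ¬? (adjacent? a i k))
    ×-dec Fin.all? (λ k → (toℕ i ℕ.≟ suc (toℕ k)) →-dec ¬? (adjacent? a k j)))

peakEdges : Vec ℕ n → List (Fin n × Fin n)
peakEdges {n} a = filter (isPeakEdge? a) (cartesianProduct (allFin n) (allFin n))

peak : Vec ℕ n → ℕ
peak a = length (peakEdges a)

-- The peak-clique of (i , j) is {i,…,j}, so distinct peak-edges have distinct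
-- peak-cliques.
peakNesting : Vec ℕ n → Fin n → ℕ
peakNesting a v =
  length (filter (λ (i , j) → (i Fin.≤? v) ×-dec (v Fin.≤? j)) (peakEdges a))

pnest : Vec ℕ n → ℕ
pnest {n} a = max 0 (map (peakNesting a) (allFin n))

𝒩 : ℕ → (n : ℕ) → List (Vec ℕ n)
𝒩 k n = filter (λ a → pnest a ℕ.≤? k) (areaSequences n)

PeakPolynomial : List (Vec ℕ n) → Poly
PeakPolynomial as = ∑[ a ∈ as ] X ^ peak a

evenBinomialSum : ℕ → Poly
evenBinomialSum m = ∑[ i ∈ upTo (suc ⌊ m /2⌋) ] (m C (2 ℕ.* i)) ×ᵖ X ^ i

data Step : Set where
  U D H : Step

_≟ˢ_ : DecidableEquality Step
U ≟ˢ U = yes refl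
U ≟ˢ D = no λ ()
U ≟ˢ H = no λ ()
D ≟ˢ U = no λ ()
D ≟ˢ D = yes refl
D ≟ˢ H = no λ ()
H ≟ˢ U = no λ ()
H ≟ˢ D = no λ ()
H ≟ˢ H = yes refl

rise : Step → ℤ.ℤ
rise U = ℤ.1ℤ
rise D = ℤ.-1ℤ
rise H = ℤ.0ℤ

-- The y-coordinates of the lattice points visited from height y on.
ordinates : ℤ.ℤ → Vec Step n → Vec ℤ.ℤ (suc n)
ordinates y []      = y ∷ []
ordinates y (s ∷ p) = y ∷ ordinates (y ℤ.+ rise s) p

IsMotzkinPath : Vec Step n → Set
IsMotzkinPath p =
  All (ℤ.0ℤ ℤ.≤_) (ordinates ℤ.0ℤ p) × last (ordinates ℤ.0ℤ p) ≡ ℤ.0ℤ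

isMotzkinPath? : (p : Vec Step n) → Dec (IsMotzkinPath p)
isMotzkinPath? p =
  All.all? (ℤ.0ℤ ℤ.≤?_) (ordinates ℤ.0ℤ p)
  ×-dec (last (ordinates ℤ.0ℤ p) ℤ.≟ ℤ.0ℤ)

motzkinPaths : (m : ℕ) → List (Vec Step m)
motzkinPaths m = filter isMotzkinPath? (vectors m (U ∷ D ∷ H ∷ []))

height : Vec Step n → ℤ.ℤ
height p = foldr′ ℤ._⊔_ ℤ.0ℤ (ordinates ℤ.0ℤ p)

upSteps : Vec Step n → ℕ
upSteps = count (_≟ˢ U)

IsMotzkinSequence : Vec ℕ n → Set
IsMotzkinSequence {n} w =
    (∀ i → 0 < lookup w i)
  × (∀ (i : Fin n) → suc (toℕ i) ≡ 1 → lookup w i ≡ 1)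
  × (∀ (i : Fin n) → suc (toℕ i) ≡ n → lookup w i ≡ 1)
  × (∀ (i j : Fin n) → toℕ j ≡ suc (toℕ i) → ∣ lookup w i - lookup w j ∣ ≤ 1)

isMotzkinSequence? : (w : Vec ℕ n) → Dec (IsMotzkinSequence w)
isMotzkinSequence? {n} w =
  Fin.all? (λ i → 0 ℕ.<? lookup w i)
  ×-dec Fin.all? (λ i → (suc (toℕ i) ℕ.≟ 1) →-dec (lookup w i ℕ.≟ 1))
  ×-dec Fin.all? (λ i → (suc (toℕ i) ℕ.≟ n) →-dec (lookup w i ℕ.≟ 1))
  ×-dec Fin.all? (λ i → Fin.all? (λ j →
    (toℕ j ℕ.≟ suc (toℕ i)) →-dec (∣ lookup w i - lookup w j ∣ ℕ.≤? 1)))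

-- The entries of a Motzkin sequence of size n are at most n.
motzkinSequences : (n : ℕ) → List (Vec ℕ n)
motzkinSequences n = filter isMotzkinSequence? (vectors n (upTo (suc n)))

motzkinSequences-unique : ∀ n → Unique (motzkinSequences n)
motzkinSequences-unique n =
  Unique.filter⁺ isMotzkinSequence? (vectors-unique n (Unique.upTo⁺ (suc n)))

motzkinSequences-complete : {w : Vec ℕ n} → IsMotzkinSequence w → w ∈ motzkinSequences n
motzkinSequences-complete {n} {w} isMotzkin@(_ , start , _ , smooth) =
  ∈-filter⁺ isMotzkinSequence?
    (vectors-complete (lookup⁻ λ i →
      ∈-upTo⁺ (s≤s (ℕ.≤-trans (bound (toℕ i) i refl) (Fin.toℕ<n i)))))
    isMotzkin
  where
  bound : ∀ k (i : Fin n) → toℕ i ≡ k → lookup w i ≤ suc k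
  bound zero    i i≡0 rewrite start i (subst (λ k → suc k ≡ 1) (sym i≡0) refl) = ℕ.≤-refl
  bound (suc k) j j≡1+k = begin
    lookup w j                                ≤⟨ ℕ.m≤n+∣n-m∣ (lookup w j) (lookup w i) ⟩
    lookup w i ℕ.+ ∣ lookup w i - lookup w j ∣ ≤⟨ ℕ.+-mono-≤ (bound k i i≡k) (smooth i j j≡1+i) ⟩
    suc k ℕ.+ 1                               ≡⟨ ℕ.+-comm (suc k) 1 ⟩
    suc (suc k)                               ∎
    where
    open ℕ.≤-Reasoning
    k<n : k < n
    k<n = ℕ.<-trans (ℕ.n<1+n k) (subst (_< n) j≡1+k (Fin.toℕ<n j))
    i : Fin n
    i = Fin.fromℕ< k<n
    i≡k : toℕ i ≡ k
    i≡k = Fin.toℕ-fromℕ< k<n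
    j≡1+i : toℕ j ≡ suc (toℕ i)
    j≡1+i rewrite i≡k = j≡1+k

largestEntry : Vec ℕ n → ℕ
largestEntry w = max 0 (toList w)

IsAscent : Vec ℕ n → Fin n → Set
IsAscent {n} w i = ∃[ j ] toℕ {n} j ≡ suc (toℕ i) × lookup w i < lookup w j

isAscent? : (w : Vec ℕ n) (i : Fin n) → Dec (IsAscent w i)
isAscent? w i =
  Fin.any? (λ j → (toℕ j ℕ.≟ suc (toℕ i)) ×-dec (lookup w i ℕ.<? lookup w j))

ascents : Vec ℕ n → ℕ
ascents {n} w = length (filter (isAscent? w) (allFin n))

{-# OPTIONS --safe #-}
module Submission where

-- With bᵢ = i - aᵢ, the peak-cliques are the intervals [bⱼ , j] for which j = n or
-- bⱼ < bⱼ₊₁, and pnest ≤ 2 says that among any three consecutive ones the third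
-- starts after the first has ended.  In passing from i to i + 1 either nothing
-- happens, or a clique ends at i and the next left endpoint is chosen to the right
-- of both bᵢ and the previous end.  The generating function of the completions is
-- affine in the number of admissible choices among 1,…,i, and its two coefficients
-- satisfy the recursion of the even and the odd part in √t of (1 + t + √t)ᵐ; the
-- even part is the gamma expansion with coefficients m C 2i.  Replacing 1 + t by 1
-- gives the closed form, and Pascal's rule in the same shape counts the Motzkin
-- paths and sequences.

open import Algebra.Bundles using (CommutativeRing)
import Algebra.Properties.CommutativeSemigroup as CommutativeSemigroupProperties
import Algebra.Properties.Ring as RingProperties
import Algebra.Properties.Semiring.Exp as Exp
import Algebra.Properties.Semiring.Mult as Mult
import Algebra.Solver.Ring.NaturalCoefficients.Default as Solver
open import Data.Empty using (⊥)
open import Data.Fin.Base as Fin using (Fin; zero; suc; toℕ; fromℕ<)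
import Data.Fin.Properties as Fin
import Data.Integer.Base as ℤ
import Data.Integer.Properties as ℤ
open import Data.List.Base
  using (List; []; _∷_; _++_; map; filter; foldr; length; upTo; allFin; applyUpTo; cartesianProduct; cartesianProductWith)
open import Data.List.Extrema.Nat using (xs≤max; max≤v⁺)
open import Data.List.Membership.Propositional using (_∈_)
open import Data.List.Membership.Propositional.Properties
  using (∈-filter⁺; ∈-filter⁻; ∈-map⁺; ∈-map⁻; ∈-allFin; ∈-cartesianProduct⁺)
open import Data.List.Membership.Propositional.Properties.WithK using (unique∧set⇒bag)
open import Data.List.Properties
  using (filter-++; filter-≐; filter-none; filter-accept; filter-reject; length-++; length-map; map-tabulate)
open import Data.List.Relation.Binary.BagAndSetEquality using (∼bag⇒↭)
open import Data.List.Relation.Binary.Permutation.Propositional using (_↭_)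
open import Data.List.Relation.Binary.Permutation.Propositional.Properties using (filter-↭; ↭-length)
open import Data.List.Relation.Unary.All as ListAll using ([]; _∷_)
import Data.List.Relation.Unary.All.Properties as ListAll
open import Data.List.Relation.Unary.AllPairs using (AllPairs; []; _∷_)
import Data.List.Relation.Unary.AllPairs.Properties as AllPairs
open import Data.List.Relation.Unary.Any using (here; there; _─_)
open import Data.List.Relation.Unary.Unique.Propositional using (Unique)
import Data.List.Relation.Unary.Unique.Propositional.Properties as Unique
open import Data.Nat.Base as ℕ
  using (ℕ; zero; suc; _∸_; _≤_; _<_; _⊓_; ⌊_/2⌋; ∣_-_∣; s≤s; s≤s⁻¹; z≤n; z<s)
open import Data.Nat.Combinatorics
  using (_C_; nCn≡1; nCk≡nC[n∸k]; nCk+nC[k+1]≡[n+1]C[k+1]; k>n⇒nCk≡0)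
import Data.Nat.Properties as ℕ
open import Data.Product.Base using (_×_; _,_; proj₁; proj₂; ∃-syntax)
open import Data.Rational.Base using (½)
import Data.Rational.Properties as ℚ
open import Data.Sum.Base using (_⊎_; inj₁; inj₂)
open import Data.Unit.Base using (⊤; tt)
open import Data.Vec.Base using (Vec; []; _∷_; lookup; head; last; initLast; foldr′; toList)
open import Data.Vec.Relation.Unary.All using (All; []; _∷_)
open import Function.Base using (_∘_; id)
open import Function.Bundles using (_⇔_; mk⇔)
open import Level using (Level)
import Relation.Binary.PropositionalEquality as ≡
open ≡ using (_≡_; _≢_)
open import Relation.Nullary using (¬_; yes; no; contradiction)
open import Relation.Nullary.Decidable using (_×-dec_)
open import Relation.Unary using (Pred; Decidable; _≐_)
import Defs

-- The count runs over states made of the current entry c and the distance e back to the last clique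
-- end; because the nesting bound is 2, only one earlier end has to be remembered. Staying raises c
-- and e by one, while a jump to entry x resets e to 1. So the minimum q of c and e becomes either q
-- + 1 or the minimum of x and 1, which is 0 or 1. The recursion therefore involves only the values
-- at q + 1, 0 and 1, and a function affine in q stays affine. The polynomial ring has no √t. The
-- even and odd parts are therefore carried as a pair of sequences over an arbitrary commutative
-- ring, and the closed form is taken at t = X², where X is a square root. Symmetry of the peak
-- polynomial is not derived from a symmetry of area sequences: it is inherited from the recursion
-- of this pair.

private variable
  ℓp ℓq ℓa ℓb ℓc : Level
  A : Set ℓa
  B : Set ℓb
  Z : Set ℓc
  m n : ℕ

-- Finite sums over index ranges and over filtered lists.

module Sums {c ℓ} (R : CommutativeRing c ℓ) where
  open CommutativeRing R hiding (_-_)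
  open Solver commutativeSemiring using (solve; _:=_; _:+_)
  open import Relation.Binary.Reasoning.Setoid setoid

  ∑< : ℕ → (ℕ → Carrier) → Carrier
  ∑< zero    f = 0#
  ∑< (suc n) f = f 0 + ∑< n (λ i → f (suc i))

  ∑<-cong : ∀ n {f g : ℕ → Carrier} → (∀ i → f i ≈ g i) → ∑< n f ≈ ∑< n g
  ∑<-cong zero    f≈g = refl
  ∑<-cong (suc n) f≈g = +-cong (f≈g 0) (∑<-cong n (λ i → f≈g (suc i)))

  ∑<-zero : ∀ n {f : ℕ → Carrier} → (∀ i → i < n → f i ≈ 0#) → ∑< n f ≈ 0#
  ∑<-zero zero    f≈0 = refl
  ∑<-zero (suc n) f≈0 =
    trans (+-cong (f≈0 0 z<s) (∑<-zero n (λ i i<n → f≈0 (suc i) (s≤s i<n)))) (+-identityˡ 0#)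

  ∑<-single : ∀ n {f : ℕ → Carrier} j → j < n → (∀ i → i < n → i ≢ j → f i ≈ 0#) →
    ∑< n f ≈ f j
  ∑<-single (suc n) zero    _   f≈0 = trans
    (+-congˡ (∑<-zero n (λ i i<n → f≈0 (suc i) (s≤s i<n) (λ ())))) (+-identityʳ _)
  ∑<-single (suc n) (suc j) j<n f≈0 = trans
    (+-cong (f≈0 0 z<s (λ ()))
      (∑<-single n j (s≤s⁻¹ j<n) (λ i i<n i≢j → f≈0 (suc i) (s≤s i<n) (λ e → i≢j (ℕ.suc-injective e)))))
    (+-identityˡ _)

  ∑<-+ : ∀ n (f g : ℕ → Carrier) → ∑< n (λ i → f i + g i) ≈ ∑< n f + ∑< n g
  ∑<-+ zero    f g = sym (+-identityˡ 0#)
  ∑<-+ (suc n) f g = trans (+-congˡ (∑<-+ n _ _))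
    (solve 4 (λ a b x y → (a :+ b) :+ (x :+ y) := (a :+ x) :+ (b :+ y)) refl _ _ _ _)

  ∑<-*ˡ : ∀ n x (f : ℕ → Carrier) → ∑< n (λ i → x * f i) ≈ x * ∑< n f
  ∑<-*ˡ zero    x f = sym (zeroʳ x)
  ∑<-*ˡ (suc n) x f = trans (+-congˡ (∑<-*ˡ n x _)) (sym (distribˡ x _ _))

  -- Over the polynomial ring this is definitionally the sum used in `PeakPolynomial`; `∑<` is the
  -- form suited to induction on the range.
  ∑ᴸ : List A → (A → Carrier) → Carrier
  ∑ᴸ xs f = foldr _+_ 0# (map f xs)

  ∑ᴸ-upTo : ∀ n (f : ℕ → Carrier) → ∑ᴸ (upTo n) f ≡ ∑< n f
  ∑ᴸ-upTo n = go n id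
    where
    go : ∀ n (g : ℕ → ℕ) (f : ℕ → Carrier) → ∑ᴸ (applyUpTo g n) f ≡ ∑< n (f ∘ g)
    go zero    g f = ≡.refl
    go (suc n) g f = ≡.cong (f (g 0) +_) (go n (g ∘ suc) f)

  ∑ᴸ-++ : (xs ys : List A) (f : A → Carrier) → ∑ᴸ (xs ++ ys) f ≈ ∑ᴸ xs f + ∑ᴸ ys f
  ∑ᴸ-++ []       ys f = sym (+-identityˡ _)
  ∑ᴸ-++ (x ∷ xs) ys f = trans (+-congˡ (∑ᴸ-++ xs ys f)) (sym (+-assoc _ _ _))

  ∑ᴸ-cong : ∀ (xs : List A) {f g : A → Carrier} → ListAll.All (λ x → f x ≈ g x) xs →
    ∑ᴸ xs f ≈ ∑ᴸ xs g
  ∑ᴸ-cong []       []              = refl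
  ∑ᴸ-cong (x ∷ xs) (fx≈gx ∷ fs≈gs) = +-cong fx≈gx (∑ᴸ-cong xs fs≈gs)

  ∑ᴸ-*ˡ : ∀ x (xs : List A) (f : A → Carrier) → ∑ᴸ xs (λ y → x * f y) ≈ x * ∑ᴸ xs f
  ∑ᴸ-*ˡ x []       f = sym (zeroʳ x)
  ∑ᴸ-*ˡ x (y ∷ ys) f = trans (+-congˡ (∑ᴸ-*ˡ x ys f)) (sym (distribˡ x _ _))

  ∑ᴸ-filter-map : {P : Pred B ℓp} (P? : Decidable P) (g : A → B) (xs : List A) (f : B → Carrier) →
    ∑ᴸ (filter P? (map g xs)) f ≡ ∑ᴸ (filter (P? ∘ g) xs) (f ∘ g)
  ∑ᴸ-filter-map P? g []       f = ≡.refl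
  ∑ᴸ-filter-map P? g (x ∷ xs) f with P? (g x)
  ... | yes _ = ≡.cong (f (g x) +_) (∑ᴸ-filter-map P? g xs f)
  ... | no  _ = ∑ᴸ-filter-map P? g xs f

  -- Since `vectors (suc n) xs` is such a product with `_∷_`, a sum over vectors becomes a sum over
  -- the first entry of sums over the tails.
  ∑ᴸ-filter-product : {P : Pred Z ℓp} (P? : Decidable P) (g : A → B → Z) (xs : List A) (ys : List B)
    (f : Z → Carrier) →
    ∑ᴸ (filter P? (cartesianProductWith g xs ys)) f ≈
    ∑ᴸ xs (λ x → ∑ᴸ (filter (P? ∘ g x) ys) (f ∘ g x))
  ∑ᴸ-filter-product P? g []       ys f = refl
  ∑ᴸ-filter-product P? g (x ∷ xs) ys f = begin
    ∑ᴸ (filter P? (map (g x) ys ++ cartesianProductWith g xs ys)) f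
      ≡⟨ ≡.cong (λ zs → ∑ᴸ zs f) (filter-++ P? (map (g x) ys) _) ⟩
    ∑ᴸ (filter P? (map (g x) ys) ++ filter P? (cartesianProductWith g xs ys)) f
      ≈⟨ ∑ᴸ-++ (filter P? (map (g x) ys)) _ f ⟩
    ∑ᴸ (filter P? (map (g x) ys)) f + ∑ᴸ (filter P? (cartesianProductWith g xs ys)) f
      ≈⟨ +-cong (reflexive (∑ᴸ-filter-map P? (g x) ys f)) (∑ᴸ-filter-product P? g xs ys f) ⟩
    ∑ᴸ (x ∷ xs) (λ x → ∑ᴸ (filter (P? ∘ g x) ys) (f ∘ g x)) ∎

-- Binomial expansion of the even and odd parts of (u + √x)ⁿ.

nC0≡1 : ∀ n → n C 0 ≡ 1
nC0≡1 n = ≡.trans (nCk≡nC[n∸k] {0} {n} z≤n) (nCn≡1 n)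

module EvenOddParts {c ℓ} (R : CommutativeRing c ℓ) where
  open CommutativeRing R hiding (_-_)
  open Sums R public
  open Mult semiring using (×-congʳ; ×-homo-+; ×-comm-*) renaming (_×_ to _×ᴿ_)
  open Exp semiring using (_^_)
  open RingProperties ring using (-‿distribˡ-*; -‿distribʳ-*; -‿involutive)
  open Solver commutativeSemiring using (solve; _:=_; _:+_; _:*_; con)
  open import Relation.Binary.Reasoning.Setoid setoid

  module _ (u x : Carrier) where

    -- even n + √x odd n = (u + √x)ⁿ
    even odd : ℕ → Carrier
    even zero    = 1#
    even (suc m) = u * even m + x * odd m
    odd zero    = 0#
    odd (suc m) = u * odd m + even m

    private
      -- The summand with (√x)ᵏ in the expansion of (u + √x)ᵐ, one factor √x being removed when k is
      -- odd. Keeping i apart from k lets a single Pascal rule serve k = 2i and k = 2i + 1.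
      term : ℕ → ℕ → ℕ → Carrier
      term m k i = (m C k) ×ᴿ (x ^ i * u ^ (m ∸ k))

      -- For k < m the exponent m ∸ (k + 1) grows by one; otherwise the subtraction truncates, but
      -- then `m C suc k` vanishes.
      u*term : ∀ m k i → u * term m (suc k) i ≈ (m C suc k) ×ᴿ (x ^ i * u ^ (m ∸ k))
      u*term m k i with suc k ℕ.≤? m
      ... | yes k<m = trans (×-comm-* (m C suc k) _ _) (×-congʳ (m C suc k) (begin
        u * (x ^ i * u ^ (m ∸ suc k))
          ≈⟨ solve 3 (λ a b d → a :* (b :* d) := b :* (a :* d)) refl _ _ _ ⟩
        x ^ i * u ^ suc (m ∸ suc k)
          ≡⟨ ≡.cong (λ j → x ^ i * u ^ j) (ℕ.+-∸-assoc 1 k<m) ⟨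
        x ^ i * u ^ (m ∸ k) ∎))
      ... | no k≮m rewrite k>n⇒nCk≡0 (ℕ.≰⇒> k≮m) = zeroʳ u

      pascal : ∀ m k i → u * term m (suc k) i + term m k i ≈ term (suc m) (suc k) i
      pascal m k i = begin
        u * term m (suc k) i + term m k i    ≈⟨ +-congʳ (u*term m k i) ⟩
        (m C suc k) ×ᴿ z + (m C k) ×ᴿ z        ≈⟨ ×-homo-+ z (m C suc k) (m C k) ⟨
        ((m C suc k) ℕ.+ (m C k)) ×ᴿ z        ≡⟨ ≡.cong (_×ᴿ z) (ℕ.+-comm (m C suc k) _) ⟩
        ((m C k) ℕ.+ (m C suc k)) ×ᴿ z        ≡⟨ ≡.cong (_×ᴿ z) (nCk+nC[k+1]≡[n+1]C[k+1] m k) ⟩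
        term (suc m) (suc k) i               ∎
        where z = x ^ i * u ^ (m ∸ k)

      even-term odd-term : ℕ → ℕ → Carrier
      even-term m i = term m (2 ℕ.* i) i
      odd-term  m i = term m (suc (2 ℕ.* i)) i

      odd-term-suc : ∀ m i → odd-term (suc m) i ≈ u * odd-term m i + even-term m i
      odd-term-suc m i = sym (pascal m (2 ℕ.* i) i)

      -- The lower neighbour of 2(i + 1) in Pascal's rule is 2i + 1, whose term carries only xⁱ; the
      -- missing factor is the x in the recursion of `even`.
      even-term-suc : ∀ m i →
        even-term (suc m) (suc i) ≈ u * even-term m (suc i) + x * odd-term m i
      even-term-suc m i = begin
        term (suc m) (2 ℕ.* suc i) (suc i)
          ≡⟨ ≡.cong (λ k → term (suc m) k (suc i)) (ℕ.*-suc 2 i) ⟩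
        term (suc m) (2 ℕ.+ 2 ℕ.* i) (suc i)
          ≈⟨ pascal m (suc (2 ℕ.* i)) (suc i) ⟨
        u * term m (2 ℕ.+ 2 ℕ.* i) (suc i) + term m (suc (2 ℕ.* i)) (suc i)
          ≈⟨ +-congˡ (trans (×-congʳ k (*-assoc x _ _)) (sym (×-comm-* k x _))) ⟩
        u * term m (2 ℕ.+ 2 ℕ.* i) (suc i) + x * odd-term m i
          ≡⟨ ≡.cong (λ k → u * term m k (suc i) + x * odd-term m i) (ℕ.*-suc 2 i) ⟨
        u * even-term m (suc i) + x * odd-term m i ∎
        where k = m C suc (2 ℕ.* i)

      even-term-zero : ∀ m → even-term (suc m) 0 ≈ u * even-term m 0
      even-term-zero m rewrite nC0≡1 m | nC0≡1 (suc m) =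
        solve 2 (λ a b → con 1 :* (a :* b) :+ con 0 := a :* (con 1 :* b :+ con 0)) refl _ _

    -- The bounds only say that no nonzero binomial is cut off. Leaving n free lets the two
    -- inductions feed each other: splitting off the term i = 0 of the even sum leaves an odd sum
    -- with one summand fewer.
    even-binomial : ∀ m n → m < 2 ℕ.* n → ∑< n (even-term m) ≈ even m
    odd-binomial  : ∀ m n → m ≤ 2 ℕ.* n → ∑< n (odd-term m) ≈ odd m
    even-binomial m       zero    ()
    even-binomial zero    (suc n) _ =
      trans (+-congˡ (∑<-zero n (λ i _ → refl))) (solve 0 (con 1 :* con 1 :+ con 0 :+ con 0 := con 1) refl)
    even-binomial (suc m) (suc n) m<n = begin
      even-term (suc m) 0 + ∑< n (λ i → even-term (suc m) (suc i))
        ≈⟨ +-cong (even-term-zero m) (trans (∑<-cong n (even-term-suc m)) (∑<-+ n _ _)) ⟩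
      u * even-term m 0 + (∑< n (λ i → u * even-term m (suc i)) + ∑< n (λ i → x * odd-term m i))
        ≈⟨ +-congˡ (+-cong (∑<-*ˡ n u _) (∑<-*ˡ n x _)) ⟩
      u * even-term m 0 + (u * ∑< n (λ i → even-term m (suc i)) + x * ∑< n (odd-term m))
        ≈⟨ solve 5 (λ u a b x d → u :* a :+ (u :* b :+ x :* d) := u :* (a :+ b) :+ x :* d) refl _ _ _ _ _ ⟩
      u * ∑< (suc n) (even-term m) + x * ∑< n (odd-term m)
        ≈⟨ +-cong (*-congˡ (even-binomial m (suc n) (ℕ.<-trans (ℕ.n<1+n m) m<n)))
                  (*-congˡ (odd-binomial m n m≤2n)) ⟩
      even (suc m) ∎
      where
      m≤2n : m ≤ 2 ℕ.* n
      m≤2n = s≤s⁻¹ (s≤s⁻¹ (≡.subst (suc (suc m) ≤_) (ℕ.*-suc 2 n) m<n))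
    odd-binomial zero    n _   = ∑<-zero n (λ i _ → refl)
    odd-binomial (suc m) n m<n = begin
      ∑< n (odd-term (suc m))                                  ≈⟨ ∑<-cong n (odd-term-suc m) ⟩
      ∑< n (λ i → u * odd-term m i + even-term m i)            ≈⟨ ∑<-+ n _ _ ⟩
      ∑< n (λ i → u * odd-term m i) + ∑< n (even-term m)       ≈⟨ +-congʳ (∑<-*ˡ n u _) ⟩
      u * ∑< n (odd-term m) + ∑< n (even-term m)
        ≈⟨ +-cong (*-congˡ (odd-binomial m n (ℕ.<⇒≤ m<n))) (even-binomial m n m<n) ⟩
      odd (suc m) ∎

  power-split : ∀ u {x y} → y * y ≈ x → ∀ m → (u + y) ^ m ≈ even u x m + y * odd u x m
  power-split u {x} {y} y²≈x zero    = solve 1 (λ y → con 1 := con 1 :+ y :* con 0) refl y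
  power-split u {x} {y} y²≈x (suc m) = begin
    (u + y) * (u + y) ^ m
      ≈⟨ *-congˡ (power-split u y²≈x m) ⟩
    (u + y) * (even u x m + y * odd u x m)
      ≈⟨ solve 4 (λ u y e o → (u :+ y) :* (e :+ y :* o) := (u :* e :+ (y :* y) :* o) :+ y :* (u :* o :+ e))
           refl u y _ _ ⟩
    (u * even u x m + (y * y) * odd u x m) + y * odd u x (suc m)
      ≈⟨ +-congʳ (+-congˡ (*-congʳ y²≈x)) ⟩
    even u x (suc m) + y * odd u x (suc m) ∎

  -- Both y and - y are square roots of x, so they share their even and odd parts, and the odd parts
  -- cancel.
  power-sum : ∀ u {x y} → y * y ≈ x → ∀ m →
    (u + y) ^ m + (u + - y) ^ m ≈ even u x m + even u x m
  power-sum u {x} {y} y²≈x m = begin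
    (u + y) ^ m + (u + - y) ^ m
      ≈⟨ +-cong (power-split u y²≈x m) (power-split u [-y]²≈x m) ⟩
    (e + y * o) + (e + - y * o)
      ≈⟨ solve 4 (λ e y z o → (e :+ y :* o) :+ (e :+ z :* o) := (e :+ e) :+ (y :+ z) :* o)
           refl e y (- y) o ⟩
    (e + e) + (y + - y) * o
      ≈⟨ +-congˡ (trans (*-congʳ (-‿inverseʳ y)) (zeroˡ o)) ⟩
    (e + e) + 0#
      ≈⟨ +-identityʳ _ ⟩
    e + e ∎
    where
    e = even u x m
    o = odd u x m
    [-y]²≈x : - y * - y ≈ x
    [-y]²≈x = begin
      - y * - y     ≈⟨ -‿distribˡ-* y (- y) ⟨
      - (y * - y)   ≈⟨ -‿cong (-‿distribʳ-* y y) ⟨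
      - (- (y * y)) ≈⟨ -‿involutive (y * y) ⟩
      y * y         ≈⟨ y²≈x ⟩
      x             ∎

-- The number of summands in `evenBinomialSum` and `gammaExpansion` meets the bound of
-- `even-binomial`.
m<2*1+⌊m/2⌋ : ∀ m → m < 2 ℕ.* suc ⌊ m /2⌋
m<2*1+⌊m/2⌋ zero          = s≤s z≤n
m<2*1+⌊m/2⌋ (suc zero)    = s≤s (s≤s z≤n)
m<2*1+⌊m/2⌋ (suc (suc m)) =
  ≡.subst (suc (suc m) <_) (≡.sym (ℕ.*-suc 2 (suc ⌊ m /2⌋))) (s≤s (s≤s (m<2*1+⌊m/2⌋ m)))

-- The commutative ring of polynomials.

module PolynomialRing {c ℓ} (R : CommutativeRing c ℓ) where
  open CommutativeRing R hiding (_-_)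
  open Defs.Polynomial R
  open Solver commutativeSemiring using (solve; _:=_; _:+_; _:*_; con)
  open RingProperties ring using (-0#≈0#)
  open import Relation.Binary.Reasoning.Setoid setoid

  coeff-+ : ∀ p q k → coeff (p +ᵖ q) k ≈ coeff p k + coeff q k
  coeff-+ []      q       k       = sym (+-identityˡ _)
  coeff-+ (x ∷ p) []      k       = sym (+-identityʳ _)
  coeff-+ (x ∷ p) (y ∷ q) zero    = refl
  coeff-+ (x ∷ p) (y ∷ q) (suc k) = coeff-+ p q k

  coeff-· : ∀ x p k → coeff (x · p) k ≈ x * coeff p k
  coeff-· x []      k       = sym (zeroʳ x)
  coeff-· x (y ∷ p) zero    = refl
  coeff-· x (y ∷ p) (suc k) = coeff-· x p k

  coeff-neg : ∀ p k → coeff (map -_ p) k ≈ - coeff p k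
  coeff-neg []      k       = sym -0#≈0#
  coeff-neg (x ∷ p) zero    = refl
  coeff-neg (x ∷ p) (suc k) = coeff-neg p k

  private
    Coeffs : Set c
    Coeffs = ℕ → Carrier

    shift : Coeffs → Coeffs
    shift f k = f (suc k)

    -- The Cauchy product. One polynomial has many lists because of trailing zeros; the
    -- multiplicative laws are therefore proved for coefficient sequences and carried back along
    -- `coeff-*-conv`.
    conv : Coeffs → Coeffs → Coeffs
    conv f g zero    = f 0 * g 0
    conv f g (suc k) = f 0 * g (suc k) + conv (shift f) g k

    conv-cong : ∀ {f f′ g g′ : Coeffs} → (∀ i → f i ≈ f′ i) → (∀ i → g i ≈ g′ i) →
      ∀ k → conv f g k ≈ conv f′ g′ k
    conv-cong f≈ g≈ zero    = *-cong (f≈ 0) (g≈ 0)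
    conv-cong f≈ g≈ (suc k) =
      +-cong (*-cong (f≈ 0) (g≈ (suc k))) (conv-cong (λ i → f≈ (suc i)) g≈ k)

    conv-zeroˡ : ∀ {f g : Coeffs} → (∀ i → f i ≈ 0#) → ∀ k → conv f g k ≈ 0#
    conv-zeroˡ f≈0 zero    = trans (*-congʳ (f≈0 0)) (zeroˡ _)
    conv-zeroˡ f≈0 (suc k) = trans
      (+-cong (trans (*-congʳ (f≈0 0)) (zeroˡ _)) (conv-zeroˡ (λ i → f≈0 (suc i)) k))
      (+-identityˡ 0#)

    conv-+ : ∀ f f′ g k → conv (λ i → f i + f′ i) g k ≈ conv f g k + conv f′ g k
    conv-+ f f′ g zero    = distribʳ _ _ _
    conv-+ f f′ g (suc k) = trans (+-congˡ (conv-+ (shift f) (shift f′) g k))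
      (solve 5 (λ a b d x y → (a :+ b) :* d :+ (x :+ y) := (a :* d :+ x) :+ (b :* d :+ y))
        refl _ _ _ _ _)

    conv-* : ∀ x f g k → conv (λ i → x * f i) g k ≈ x * conv f g k
    conv-* x f g zero    = *-assoc _ _ _
    conv-* x f g (suc k) = trans (+-congˡ (conv-* x (shift f) g k))
      (solve 4 (λ x a b d → (x :* a) :* b :+ x :* d := x :* (a :* b :+ d)) refl _ _ _ _)

    -- The definition splits off the first coefficient of the left factor; commutativity needs the
    -- same splitting for the right factor.
    conv-last : ∀ f g k → conv f g (suc k) ≈ conv f (shift g) k + f (suc k) * g 0
    conv-last f g zero    = refl
    conv-last f g (suc k) =
      trans (+-congˡ (conv-last (shift f) g k)) (sym (+-assoc _ _ _))

    conv-comm : ∀ f g k → conv f g k ≈ conv g f k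
    conv-comm f g zero    = *-comm _ _
    conv-comm f g (suc k) = begin
      f 0 * g (suc k) + conv (shift f) g k ≈⟨ +-cong (*-comm _ _) (conv-comm (shift f) g k) ⟩
      g (suc k) * f 0 + conv g (shift f) k ≈⟨ +-comm _ _ ⟩
      conv g (shift f) k + g (suc k) * f 0 ≈⟨ conv-last g f k ⟨
      conv g f (suc k)                     ∎

    conv-assoc : ∀ f g h k → conv (conv f g) h k ≈ conv f (conv g h) k
    conv-assoc f g h zero    = *-assoc _ _ _
    conv-assoc f g h (suc k) = begin
      (f 0 * g 0) * h (suc k) + conv (shift (conv f g)) h k
        -- `shift (conv f g)` unfolds pointwise to the sum that `conv-+` splits here.
        ≈⟨ +-congˡ (conv-+ (λ i → f 0 * g (suc i)) (conv (shift f) g) h k) ⟩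
      (f 0 * g 0) * h (suc k) + (conv (λ i → f 0 * g (suc i)) h k + conv (conv (shift f) g) h k)
        ≈⟨ +-congˡ (+-cong (conv-* (f 0) (shift g) h k) (conv-assoc (shift f) g h k)) ⟩
      (f 0 * g 0) * h (suc k) + (f 0 * conv (shift g) h k + conv (shift f) (conv g h) k)
        ≈⟨ solve 5 (λ a b d x y → (a :* b) :* d :+ (a :* x :+ y) := a :* (b :* d :+ x) :+ y)
             refl _ _ _ _ _ ⟩
      f 0 * conv g h (suc k) + conv (shift f) (conv g h) k ∎

    coeff-*-conv : ∀ p q k → coeff (p *ᵖ q) k ≈ conv (coeff p) (coeff q) k
    coeff-*-conv []      q k       = sym (conv-zeroˡ (λ _ → refl) k)
    coeff-*-conv (x ∷ p) q zero    =
      trans (coeff-+ (x · q) _ 0) (trans (+-identityʳ _) (coeff-· x q 0))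
    coeff-*-conv (x ∷ p) q (suc k) = trans (coeff-+ (x · q) _ (suc k))
      (+-cong (coeff-· x q (suc k)) (coeff-*-conv p q k))

    coeff-*-conv₂ : ∀ {f g : Coeffs} p q → (∀ i → coeff p i ≈ f i) → (∀ i → coeff q i ≈ g i) →
      ∀ k → coeff (p *ᵖ q) k ≈ conv f g k
    coeff-*-conv₂ p q p≈f q≈g k = trans (coeff-*-conv p q k) (conv-cong p≈f q≈g k)

    *ᵖ-comm : ∀ p q → p *ᵖ q ≈ᵖ q *ᵖ p
    *ᵖ-comm p q k = trans (coeff-*-conv p q k)
      (trans (conv-comm (coeff p) (coeff q) k) (sym (coeff-*-conv q p k)))

    *ᵖ-distribʳ : ∀ r p q → (p +ᵖ q) *ᵖ r ≈ᵖ p *ᵖ r +ᵖ q *ᵖ r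
    *ᵖ-distribʳ r p q k = begin
      coeff ((p +ᵖ q) *ᵖ r) k
        ≈⟨ coeff-*-conv₂ (p +ᵖ q) r (coeff-+ p q) (λ _ → refl) k ⟩
      conv (λ i → coeff p i + coeff q i) (coeff r) k
        ≈⟨ conv-+ (coeff p) (coeff q) (coeff r) k ⟩
      conv (coeff p) (coeff r) k + conv (coeff q) (coeff r) k
        ≈⟨ +-cong (coeff-*-conv p r k) (coeff-*-conv q r k) ⟨
      coeff (p *ᵖ r) k + coeff (q *ᵖ r) k
        ≈⟨ coeff-+ (p *ᵖ r) (q *ᵖ r) k ⟨
      coeff (p *ᵖ r +ᵖ q *ᵖ r) k ∎

    *ᵖ-identityˡ : ∀ p → 1ᵖ *ᵖ p ≈ᵖ p
    *ᵖ-identityˡ p zero    = trans (coeff-*-conv 1ᵖ p 0) (*-identityˡ _)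
    *ᵖ-identityˡ p (suc k) = trans (coeff-*-conv 1ᵖ p (suc k))
      (trans (+-cong (*-identityˡ _) (conv-zeroˡ (λ _ → refl) k)) (+-identityʳ _))

  polynomialRing : CommutativeRing c ℓ
  polynomialRing = record
    { Carrier = Poly
    ; _≈_     = _≈ᵖ_
    ; _+_     = _+ᵖ_
    ; _*_     = _*ᵖ_
    ; -_      = map -_
    ; 0#      = 0ᵖ
    ; 1#      = 1ᵖ
    ; isCommutativeRing = record
      { isRing = record
        { +-isAbelianGroup = record
          { isGroup = record
            { isMonoid = record
              { isSemigroup = record
                { isMagma = record
                  { isEquivalence = record
                    { refl  = λ k → refl
                    ; sym   = λ p≈q k → sym (p≈q k)
                    ; trans = λ p≈q q≈r k → trans (p≈q k) (q≈r k)
                    }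
                  ; ∙-cong = λ {p} {p′} {q} {q′} p≈p′ q≈q′ k →
                      trans (coeff-+ p q k)
                        (trans (+-cong (p≈p′ k) (q≈q′ k)) (sym (coeff-+ p′ q′ k)))
                  }
                ; assoc = λ p q r k → begin
                    coeff (p +ᵖ q +ᵖ r) k                 ≈⟨ coeff-+ (p +ᵖ q) r k ⟩
                    coeff (p +ᵖ q) k + coeff r k          ≈⟨ +-congʳ (coeff-+ p q k) ⟩
                    coeff p k + coeff q k + coeff r k     ≈⟨ +-assoc _ _ _ ⟩
                    coeff p k + (coeff q k + coeff r k)   ≈⟨ +-congˡ (coeff-+ q r k) ⟨
                    coeff p k + coeff (q +ᵖ r) k          ≈⟨ coeff-+ p (q +ᵖ r) k ⟨
                    coeff (p +ᵖ (q +ᵖ r)) k               ∎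
                }
              ; identity = (λ p k → refl)
                         , (λ p k → trans (coeff-+ p [] k) (+-identityʳ _))
              }
            ; inverse = (λ p k → trans (coeff-+ (map -_ p) p k)
                          (trans (+-congʳ (coeff-neg p k)) (-‿inverseˡ _)))
                      , (λ p k → trans (coeff-+ p (map -_ p) k)
                          (trans (+-congˡ (coeff-neg p k)) (-‿inverseʳ _)))
            ; ⁻¹-cong = λ {p} {q} p≈q k →
                trans (coeff-neg p k) (trans (-‿cong (p≈q k)) (sym (coeff-neg q k)))
            }
          ; comm = λ p q k →
              trans (coeff-+ p q k) (trans (+-comm _ _) (sym (coeff-+ q p k)))
          }
        ; *-cong = λ {p} {p′} {q} {q′} p≈p′ q≈q′ k →
            trans (coeff-*-conv₂ p q p≈p′ q≈q′ k) (sym (coeff-*-conv p′ q′ k))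
        ; *-assoc = λ p q r k → begin
            coeff (p *ᵖ q *ᵖ r) k
              ≈⟨ coeff-*-conv₂ (p *ᵖ q) r (coeff-*-conv p q) (λ _ → refl) k ⟩
            conv (conv (coeff p) (coeff q)) (coeff r) k
              ≈⟨ conv-assoc (coeff p) (coeff q) (coeff r) k ⟩
            conv (coeff p) (conv (coeff q) (coeff r)) k
              ≈⟨ coeff-*-conv₂ p (q *ᵖ r) (λ _ → refl) (coeff-*-conv q r) k ⟨
            coeff (p *ᵖ (q *ᵖ r)) k ∎
        ; *-identity = *ᵖ-identityˡ
                     , (λ p k → trans (*ᵖ-comm p 1ᵖ k) (*ᵖ-identityˡ p k))
        ; distrib = (λ p q r k → begin
                        coeff (p *ᵖ (q +ᵖ r)) k      ≈⟨ *ᵖ-comm p (q +ᵖ r) k ⟩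
                        coeff ((q +ᵖ r) *ᵖ p) k      ≈⟨ *ᵖ-distribʳ p q r k ⟩
                        coeff (q *ᵖ p +ᵖ r *ᵖ p) k   ≈⟨ coeff-+ (q *ᵖ p) (r *ᵖ p) k ⟩
                        coeff (q *ᵖ p) k + coeff (r *ᵖ p) k
                          ≈⟨ +-cong (*ᵖ-comm q p k) (*ᵖ-comm r p k) ⟩
                        coeff (p *ᵖ q) k + coeff (p *ᵖ r) k
                          ≈⟨ coeff-+ (p *ᵖ q) (p *ᵖ r) k ⟨
                        coeff (p *ᵖ q +ᵖ p *ᵖ r) k   ∎)
                  , *ᵖ-distribʳ
        }
      ; *-comm = *ᵖ-comm
      }
    }

  coeff-X*-zero : ∀ p → coeff (X *ᵖ p) 0 ≈ 0#
  coeff-X*-zero p = trans (coeff-*-conv X p 0) (zeroˡ _)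

  coeff-X*-suc : ∀ p k → coeff (X *ᵖ p) (suc k) ≈ coeff p k
  coeff-X*-suc p zero    = trans (coeff-*-conv X p 1)
    (solve 2 (λ a b → con 0 :* a :+ con 1 :* b := b) refl (coeff p 1) (coeff p 0))
  coeff-X*-suc p (suc k) = trans (coeff-*-conv X p (suc (suc k)))
    (trans (+-cong (zeroˡ _) (+-cong (*-identityˡ _) (conv-zeroˡ (λ _ → refl) k)))
      (trans (+-identityˡ _) (+-identityʳ _)))

-- Gamma expansion, substitution and symmetry of the even part.

module PolynomialIdentities {c ℓ} (R : CommutativeRing c ℓ) where
  open CommutativeRing R hiding (_-_)
  open Defs.Polynomial R
  open PolynomialRing R
  open Mult semiring using () renaming (_×_ to _×ᴿ_)
  open EvenOddParts R using () renaming (∑< to ∑<ᴿ; ∑<-zero to ∑<ᴿ-zero; ∑<-single to ∑<ᴿ-single)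
  open EvenOddParts polynomialRing
  private module ᴾ where
    open CommutativeRing polynomialRing public
    open Mult (CommutativeRing.semiring polynomialRing) public
  private module ᴾ+ = CommutativeSemigroupProperties (CommutativeRing.+-commutativeSemigroup polynomialRing)
  open import Relation.Binary.Reasoning.MultiSetoid

  coeff-∑< : ∀ n f k → coeff (∑< n f) k ≈ ∑<ᴿ n (λ i → coeff (f i) k)
  coeff-∑< zero    f k = refl
  coeff-∑< (suc n) f k = trans (coeff-+ (f 0) _ k) (+-congˡ (coeff-∑< n (f ∘ suc) k))

  -- Links the natural multiples in `evenBinomialSum` to the scalar multiples in `gammaExpansion`.
  ×ᵖ-· : ∀ n p → n ×ᵖ p ≈ᵖ (n ×ᴿ 1#) · p
  ×ᵖ-· zero    p k = sym (trans (coeff-· 0# p k) (zeroˡ _))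
  ×ᵖ-· (suc n) p k = begin⟨ setoid ⟩
    coeff (p +ᵖ n ×ᵖ p) k                  ≈⟨ coeff-+ p (n ×ᵖ p) k ⟩
    coeff p k + coeff (n ×ᵖ p) k
      ≈⟨ +-cong (sym (*-identityˡ _)) (trans (×ᵖ-· n p k) (coeff-· _ p k)) ⟩
    1# * coeff p k + (n ×ᴿ 1#) * coeff p k ≈⟨ distribʳ _ _ _ ⟨
    (suc n ×ᴿ 1#) * coeff p k              ≈⟨ coeff-· _ p k ⟨
    coeff ((suc n ×ᴿ 1#) · p) k            ∎

  ·-congʳ : ∀ {a b} p → a ≈ b → a · p ≈ᵖ b · p
  ·-congʳ {a} {b} p a≈b k =
    trans (coeff-· a p k) (trans (*-congʳ a≈b) (sym (coeff-· b p k)))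

  coeff-X^-same : ∀ i → coeff (X ^ i) i ≈ 1#
  coeff-X^-same zero    = refl
  coeff-X^-same (suc i) = trans (coeff-X*-suc (X ^ i) i) (coeff-X^-same i)

  coeff-X^-other : ∀ i {k} → i ≢ k → coeff (X ^ i) k ≈ 0#
  coeff-X^-other zero    {zero}  i≢k = contradiction ≡.refl i≢k
  coeff-X^-other zero    {suc k} i≢k = refl
  coeff-X^-other (suc i) {zero}  i≢k = coeff-X*-zero (X ^ i)
  coeff-X^-other (suc i) {suc k} i≢k =
    trans (coeff-X*-suc (X ^ i) k) (coeff-X^-other i (i≢k ∘ ≡.cong suc))

  coeff-monomial-same : ∀ a i → coeff (a · X ^ i) i ≈ a
  coeff-monomial-same a i =
    trans (coeff-· a (X ^ i) i) (trans (*-congˡ (coeff-X^-same i)) (*-identityʳ a))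

  coeff-monomial-other : ∀ a i {k} → i ≢ k → coeff (a · X ^ i) k ≈ 0#
  coeff-monomial-other a i {k} i≢k =
    trans (coeff-· a (X ^ i) k) (trans (*-congˡ (coeff-X^-other i i≢k)) (zeroʳ a))

  coeff-∑-monomials : ∀ n (a : ℕ → Carrier) k → (n ≤ k → a k ≈ 0#) →
    coeff (∑< n (λ i → a i · X ^ i)) k ≈ a k
  coeff-∑-monomials n a k a≈0 = trans (coeff-∑< n (λ i → a i · X ^ i) k) selected
    where
    selected : ∑<ᴿ n (λ i → coeff (a i · X ^ i) k) ≈ a k
    selected with k ℕ.<? n
    ... | yes k<n = trans
      (∑<ᴿ-single n k k<n (λ i _ i≢k → coeff-monomial-other (a i) i i≢k))
      (coeff-monomial-same (a k) k)
    ... | no  k≮n = trans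
      (∑<ᴿ-zero n (λ i i<n → coeff-monomial-other (a i) i
        (λ i≡k → k≮n (≡.subst (_< n) i≡k i<n))))
      (sym (a≈0 (ℕ.≮⇒≥ k≮n)))

  -- Restated over an arbitrary R; over the rationals it is `evenBinomialSum` by definition.
  evenBinomials : ℕ → Poly
  evenBinomials m = ∑[ i ∈ upTo (suc ⌊ m /2⌋) ] (m C (2 ℕ.* i)) ×ᵖ X ^ i

  ⌊m/2⌋<k⇒mC2k≡0 : ∀ m {k} → ⌊ m /2⌋ < k → m C (2 ℕ.* k) ≡ 0
  ⌊m/2⌋<k⇒mC2k≡0 m ⌊m/2⌋<k =
    k>n⇒nCk≡0 (ℕ.<-≤-trans (m<2*1+⌊m/2⌋ m) (ℕ.*-monoʳ-≤ 2 ⌊m/2⌋<k))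

  coeff-evenBinomials : ∀ m k → coeff (evenBinomials m) k ≈ (m C (2 ℕ.* k)) ×ᴿ 1#
  coeff-evenBinomials m k = go (suc ⌊ m /2⌋) (⌊m/2⌋<k⇒mC2k≡0 m)
    where
    -- A variable number of summands keeps `upTo` from unfolding at its first element.
    go : ∀ n → (n ≤ k → m C (2 ℕ.* k) ≡ 0) →
      coeff (∑[ i ∈ upTo n ] (m C (2 ℕ.* i)) ×ᵖ X ^ i) k ≈ (m C (2 ℕ.* k)) ×ᴿ 1#
    go n C≡0 = begin⟨ setoid ⟩
      coeff (∑[ i ∈ upTo n ] (m C (2 ℕ.* i)) ×ᵖ X ^ i) k
        ≈⟨ reflexive (≡.cong (λ p → coeff p k) (∑ᴸ-upTo n (λ i → (m C (2 ℕ.* i)) ×ᵖ X ^ i))) ⟩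
      coeff (∑< n (λ i → (m C (2 ℕ.* i)) ×ᵖ X ^ i)) k
        ≈⟨ ∑<-cong n {λ i → (m C (2 ℕ.* i)) ×ᵖ X ^ i} {λ i → ((m C (2 ℕ.* i)) ×ᴿ 1#) · X ^ i}
             (λ i → ×ᵖ-· (m C (2 ℕ.* i)) (X ^ i)) k ⟩
      coeff (∑< n (λ i → ((m C (2 ℕ.* i)) ×ᴿ 1#) · X ^ i)) k
        ≈⟨ coeff-∑-monomials n (λ i → (m C (2 ℕ.* i)) ×ᴿ 1#) k
             (λ n≤k → reflexive (≡.cong (_×ᴿ 1#) (C≡0 n≤k))) ⟩
      (m C (2 ℕ.* k)) ×ᴿ 1# ∎

  gammaExpansion-evenBinomials : ∀ m →
    gammaExpansion m (evenBinomials m) ≈ᵖ even (1ᵖ +ᵖ X) X m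
  gammaExpansion-evenBinomials m = go (suc ⌊ m /2⌋) (m<2*1+⌊m/2⌋ m)
    where
    z : ℕ → Poly
    z i = X ^ i *ᵖ (1ᵖ +ᵖ X) ^ (m ∸ 2 ℕ.* i)
    go : ∀ n → m < 2 ℕ.* n →
      (∑[ i ∈ upTo n ] coeff (evenBinomials m) i · z i) ≈ᵖ even (1ᵖ +ᵖ X) X m
    go n m<2n = begin⟨ ᴾ.setoid ⟩
      (∑[ i ∈ upTo n ] coeff (evenBinomials m) i · z i)
        ≈⟨ ᴾ.reflexive (∑ᴸ-upTo n (λ i → coeff (evenBinomials m) i · z i)) ⟩
      ∑< n (λ i → coeff (evenBinomials m) i · z i)
        ≈⟨ ∑<-cong n {λ i → coeff (evenBinomials m) i · z i} {λ i → (m C (2 ℕ.* i)) ×ᵖ z i}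
             (λ i k → trans (·-congʳ (z i) (coeff-evenBinomials m i) k)
                            (sym (×ᵖ-· (m C (2 ℕ.* i)) (z i) k))) ⟩
      ∑< n (λ i → (m C (2 ℕ.* i)) ×ᵖ z i)
        ≈⟨ even-binomial (1ᵖ +ᵖ X) X m n m<2n ⟩
      even (1ᵖ +ᵖ X) X m ∎

  -- p ≈ᵖ q unfolds to a family of equations from which p and q cannot be inferred.
  +ᵖ-congˡ : ∀ p q q′ → q ≈ᵖ q′ → p +ᵖ q ≈ᵖ p +ᵖ q′
  +ᵖ-congˡ p q q′ = ᴾ.+-congˡ {p} {q} {q′}

  *ᵖ-congˡ : ∀ p q q′ → q ≈ᵖ q′ → p *ᵖ q ≈ᵖ p *ᵖ q′
  *ᵖ-congˡ p q q′ = ᴾ.*-congˡ {p} {q} {q′}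

  interchange : ∀ x y r p q → (x +ᵖ y) +ᵖ r *ᵖ (p +ᵖ q) ≈ᵖ (x +ᵖ r *ᵖ p) +ᵖ (y +ᵖ r *ᵖ q)
  interchange x y r p q k =
    trans (+ᵖ-congˡ (x +ᵖ y) (r *ᵖ (p +ᵖ q)) (r *ᵖ p +ᵖ r *ᵖ q) (ᴾ.distribˡ r p q) k)
      (ᴾ+.interchange x y (r *ᵖ p) (r *ᵖ q) k)

  0∷[]≈0 : (0# ∷ []) ≈ᵖ 0ᵖ
  0∷[]≈0 zero    = refl
  0∷[]≈0 (suc k) = refl

  module _ (r : Poly) where

    ⟨⟩-+ : ∀ p q → (p +ᵖ q) ⟨ r ⟩ ≈ᵖ p ⟨ r ⟩ +ᵖ q ⟨ r ⟩
    ⟨⟩-+ []      q       = λ k → refl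
    ⟨⟩-+ (x ∷ p) []      = λ k → sym (ᴾ.+-identityʳ ((x ∷ p) ⟨ r ⟩) k)
    ⟨⟩-+ (x ∷ p) (y ∷ q) = begin⟨ ᴾ.setoid ⟩
      (x + y ∷ []) +ᵖ r *ᵖ ((p +ᵖ q) ⟨ r ⟩)
        ≈⟨ +ᵖ-congˡ (x + y ∷ []) (r *ᵖ ((p +ᵖ q) ⟨ r ⟩)) (r *ᵖ (p ⟨ r ⟩ +ᵖ q ⟨ r ⟩))
             (*ᵖ-congˡ r ((p +ᵖ q) ⟨ r ⟩) (p ⟨ r ⟩ +ᵖ q ⟨ r ⟩) (⟨⟩-+ p q)) ⟩
      (x ∷ []) +ᵖ (y ∷ []) +ᵖ r *ᵖ (p ⟨ r ⟩ +ᵖ q ⟨ r ⟩)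
        ≈⟨ interchange (x ∷ []) (y ∷ []) r (p ⟨ r ⟩) (q ⟨ r ⟩) ⟩
      ((x ∷ []) +ᵖ r *ᵖ (p ⟨ r ⟩)) +ᵖ ((y ∷ []) +ᵖ r *ᵖ (q ⟨ r ⟩)) ∎

    ⟨⟩-∑< : ∀ n f → ∑< n f ⟨ r ⟩ ≈ᵖ ∑< n (λ i → f i ⟨ r ⟩)
    ⟨⟩-∑< zero    f k = refl
    ⟨⟩-∑< (suc n) f k = trans (⟨⟩-+ (f 0) _ k)
      (+ᵖ-congˡ (f 0 ⟨ r ⟩) (∑< n (f ∘ suc) ⟨ r ⟩) (∑< n (λ i → f (suc i) ⟨ r ⟩))
        (⟨⟩-∑< n (f ∘ suc)) k)

    ⟨⟩-× : ∀ n p → (n ×ᵖ p) ⟨ r ⟩ ≈ᵖ n ×ᵖ (p ⟨ r ⟩)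
    ⟨⟩-× zero    p k = refl
    ⟨⟩-× (suc n) p k = trans (⟨⟩-+ p (n ×ᵖ p) k)
      (+ᵖ-congˡ (p ⟨ r ⟩) ((n ×ᵖ p) ⟨ r ⟩) (n ×ᵖ (p ⟨ r ⟩)) (⟨⟩-× n p) k)

    constant-cong : ∀ {x y} → x ≈ y → (x ∷ []) ≈ᵖ (y ∷ [])
    constant-cong x≈y zero    = x≈y
    constant-cong x≈y (suc k) = refl

    -- Horner's rule follows the list, and equal polynomials may be lists of different lengths:
    -- `⟨⟩-cong` needs that a surplus of zeros contributes nothing.
    ⟨⟩-zero : ∀ p → (∀ k → coeff p k ≈ 0#) → p ⟨ r ⟩ ≈ᵖ 0ᵖ
    ⟨⟩-zero []      p≈0 = λ k → refl
    ⟨⟩-zero (x ∷ p) p≈0 = begin⟨ ᴾ.setoid ⟩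
      (x ∷ []) +ᵖ r *ᵖ (p ⟨ r ⟩)
        ≈⟨ +ᵖ-congˡ (x ∷ []) (r *ᵖ (p ⟨ r ⟩)) (r *ᵖ 0ᵖ)
             (*ᵖ-congˡ r (p ⟨ r ⟩) 0ᵖ (⟨⟩-zero p (p≈0 ∘ suc))) ⟩
      (x ∷ []) +ᵖ r *ᵖ 0ᵖ ≈⟨ +ᵖ-congˡ (x ∷ []) (r *ᵖ 0ᵖ) 0ᵖ (ᴾ.zeroʳ r) ⟩
      (x ∷ [])            ≈⟨ constant-cong (p≈0 0) ⟩
      (0# ∷ [])           ≈⟨ 0∷[]≈0 ⟩
      0ᵖ                  ∎

    ⟨⟩-cong : ∀ p q → p ≈ᵖ q → p ⟨ r ⟩ ≈ᵖ q ⟨ r ⟩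
    ⟨⟩-cong []      q       p≈q = λ k → sym (⟨⟩-zero q (λ k → sym (p≈q k)) k)
    ⟨⟩-cong (x ∷ p) []      p≈q = ⟨⟩-zero (x ∷ p) p≈q
    ⟨⟩-cong (x ∷ p) (y ∷ q) p≈q = begin⟨ ᴾ.setoid ⟩
      (x ∷ []) +ᵖ r *ᵖ (p ⟨ r ⟩)
        ≈⟨ +ᵖ-congˡ (x ∷ []) (r *ᵖ (p ⟨ r ⟩)) (r *ᵖ (q ⟨ r ⟩))
             (*ᵖ-congˡ r (p ⟨ r ⟩) (q ⟨ r ⟩) (⟨⟩-cong p q (p≈q ∘ suc))) ⟩
      (x ∷ []) +ᵖ r *ᵖ (q ⟨ r ⟩)
        ≈⟨ ᴾ.+-congʳ {r *ᵖ (q ⟨ r ⟩)} {x ∷ []} {y ∷ []} (constant-cong (p≈q 0)) ⟩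
      (y ∷ []) +ᵖ r *ᵖ (q ⟨ r ⟩) ∎

    ⟨⟩-X^ : ∀ i → (X ^ i) ⟨ r ⟩ ≈ᵖ r ^ i
    ⟨⟩-X^ zero    k = trans (+ᵖ-congˡ 1ᵖ (r *ᵖ 0ᵖ) 0ᵖ (ᴾ.zeroʳ r) k) (ᴾ.+-identityʳ 1ᵖ k)
    ⟨⟩-X^ (suc i) = begin⟨ ᴾ.setoid ⟩
      (X *ᵖ X ^ i) ⟨ r ⟩
        -- The product with X has the coefficients of a list beginning with zero, on which Horner's
        -- rule takes one step.
        ≈⟨ ⟨⟩-cong (X *ᵖ X ^ i) (0# ∷ X ^ i)
             (λ { zero → coeff-X*-zero (X ^ i) ; (suc k) → coeff-X*-suc (X ^ i) k }) ⟩
      (0# ∷ []) +ᵖ r *ᵖ ((X ^ i) ⟨ r ⟩)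
        ≈⟨ ᴾ.+-congʳ {r *ᵖ ((X ^ i) ⟨ r ⟩)} {0# ∷ []} {0ᵖ} 0∷[]≈0 ⟩
      r *ᵖ ((X ^ i) ⟨ r ⟩)
        ≈⟨ *ᵖ-congˡ r ((X ^ i) ⟨ r ⟩) (r ^ i) (⟨⟩-X^ i) ⟩
      r *ᵖ r ^ i ∎

    -- The expansion of `even-binomial` at u = 1; powers of 1 are inserted to bring the summands
    -- into its form.
    evenBinomials-⟨⟩ : ∀ m → evenBinomials m ⟨ r ⟩ ≈ᵖ even 1ᵖ r m
    evenBinomials-⟨⟩ m = go (suc ⌊ m /2⌋) (m<2*1+⌊m/2⌋ m)
      where
      1^j≈1 : ∀ j → 1ᵖ ^ j ≈ᵖ 1ᵖ
      1^j≈1 zero    k = refl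
      1^j≈1 (suc j) k = trans (ᴾ.*-identityˡ (1ᵖ ^ j) k) (1^j≈1 j k)
      [X^i]⟨r⟩≈r^i*1^j : ∀ i j → (X ^ i) ⟨ r ⟩ ≈ᵖ r ^ i *ᵖ 1ᵖ ^ j
      [X^i]⟨r⟩≈r^i*1^j i j = begin⟨ ᴾ.setoid ⟩
        (X ^ i) ⟨ r ⟩     ≈⟨ ⟨⟩-X^ i ⟩
        r ^ i             ≈⟨ ᴾ.*-identityʳ (r ^ i) ⟨
        r ^ i *ᵖ 1ᵖ       ≈⟨ *ᵖ-congˡ (r ^ i) (1ᵖ ^ j) 1ᵖ (1^j≈1 j) ⟨
        r ^ i *ᵖ 1ᵖ ^ j   ∎
      ×-cong : ∀ n p q → p ≈ᵖ q → n ×ᵖ p ≈ᵖ n ×ᵖ q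
      ×-cong n p q p≈q = ᴾ.×-congʳ n {p} {q} p≈q
      go : ∀ n → m < 2 ℕ.* n →
        (∑[ i ∈ upTo n ] (m C (2 ℕ.* i)) ×ᵖ X ^ i) ⟨ r ⟩ ≈ᵖ even 1ᵖ r m
      go n m<2n = begin⟨ ᴾ.setoid ⟩
        (∑[ i ∈ upTo n ] (m C (2 ℕ.* i)) ×ᵖ X ^ i) ⟨ r ⟩
          ≈⟨ ᴾ.reflexive (≡.cong (_⟨ r ⟩) (∑ᴸ-upTo n (λ i → (m C (2 ℕ.* i)) ×ᵖ X ^ i))) ⟩
        ∑< n (λ i → (m C (2 ℕ.* i)) ×ᵖ X ^ i) ⟨ r ⟩
          ≈⟨ ⟨⟩-∑< n (λ i → (m C (2 ℕ.* i)) ×ᵖ X ^ i) ⟩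
        ∑< n (λ i → ((m C (2 ℕ.* i)) ×ᵖ X ^ i) ⟨ r ⟩)
          ≈⟨ ∑<-cong n {λ i → ((m C (2 ℕ.* i)) ×ᵖ X ^ i) ⟨ r ⟩}
               {λ i → (m C (2 ℕ.* i)) ×ᵖ (r ^ i *ᵖ 1ᵖ ^ (m ∸ 2 ℕ.* i))}
               (λ i k → trans (⟨⟩-× (m C (2 ℕ.* i)) (X ^ i) k)
                 (×-cong (m C (2 ℕ.* i)) ((X ^ i) ⟨ r ⟩) (r ^ i *ᵖ 1ᵖ ^ (m ∸ 2 ℕ.* i))
                   ([X^i]⟨r⟩≈r^i*1^j i (m ∸ 2 ℕ.* i)) k)) ⟩
        ∑< n (λ i → (m C (2 ℕ.* i)) ×ᵖ (r ^ i *ᵖ 1ᵖ ^ (m ∸ 2 ℕ.* i)))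
          ≈⟨ even-binomial 1ᵖ r m n m<2n ⟩
        even 1ᵖ r m ∎

  -- Here h is one half: `power-sum` at y = X yields twice the even part.
  evenBinomials-X² : ∀ {h} → h + h ≈ 1# → ∀ m →
    evenBinomials m ⟨ X ^ 2 ⟩ ≈ᵖ h · ((1ᵖ +ᵖ X) ^ m +ᵖ (1ᵖ -ᵖ X) ^ m)
  evenBinomials-X² {h} h+h≈1 m k = begin⟨ setoid ⟩
    coeff (evenBinomials m ⟨ X ^ 2 ⟩) k ≈⟨ evenBinomials-⟨⟩ (X ^ 2) m k ⟩
    coeff e k                           ≈⟨ *-identityˡ _ ⟨
    1# * coeff e k                      ≈⟨ *-congʳ h+h≈1 ⟨
    (h + h) * coeff e k                 ≈⟨ distribʳ _ _ _ ⟩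
    h * coeff e k + h * coeff e k       ≈⟨ distribˡ _ _ _ ⟨
    h * (coeff e k + coeff e k)         ≈⟨ *-congˡ (coeff-+ e e k) ⟨
    h * coeff (e +ᵖ e) k                ≈⟨ *-congˡ (power-sum 1ᵖ {X ^ 2} {X} X*X≈X² m k) ⟨
    h * coeff ((1ᵖ +ᵖ X) ^ m +ᵖ (1ᵖ -ᵖ X) ^ m) k
      ≈⟨ coeff-· h ((1ᵖ +ᵖ X) ^ m +ᵖ (1ᵖ -ᵖ X) ^ m) k ⟨
    coeff (h · ((1ᵖ +ᵖ X) ^ m +ᵖ (1ᵖ -ᵖ X) ^ m)) k ∎
    where
    e = even 1ᵖ (X ^ 2) m
    X*X≈X² : X *ᵖ X ≈ᵖ X ^ 2
    X*X≈X² = *ᵖ-congˡ X X (X *ᵖ 1ᵖ) (λ k → sym (ᴾ.*-identityʳ X k))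

  -- Symmetry about d/2 where d only bounds the degree, so that the notion contains zero and is
  -- closed under sums.
  record Palindromic (d : ℕ) (p : Poly) : Set ℓ where
    field
      mirror : ∀ i j → i ℕ.+ j ≡ d → coeff p i ≈ coeff p j
      bound  : ∀ k → d < k → coeff p k ≈ 0#

  open Palindromic

  palindromic-+ : ∀ {d p q} → Palindromic d p → Palindromic d q → Palindromic d (p +ᵖ q)
  palindromic-+ {d} {p} {q} P Q = record
    { mirror = λ i j e → trans (coeff-+ p q i)
        (trans (+-cong (mirror P i j e) (mirror Q i j e)) (sym (coeff-+ p q j)))
    ; bound  = λ k d<k → trans (coeff-+ p q k)
        (trans (+-cong (bound P k d<k) (bound Q k d<k)) (+-identityˡ 0#))
    }

  -- Multiplication by t moves the centre d/2 by one, so d grows by two; the new outermost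
  -- coefficients, at 0 and d + 2, both vanish.
  palindromic-X* : ∀ {d p} → Palindromic d p → Palindromic (2 ℕ.+ d) (X *ᵖ p)
  palindromic-X* {d} {p} P = record { mirror = mirror′ ; bound = bound′ }
    where
    bound′ : ∀ k → 2 ℕ.+ d < k → coeff (X *ᵖ p) k ≈ 0#
    bound′ (suc k) d<k = trans (coeff-X*-suc p k) (bound P k (ℕ.≤-trans (ℕ.n≤1+n _) (s≤s⁻¹ d<k)))
    top : ∀ j → j ≡ 2 ℕ.+ d → coeff (X *ᵖ p) j ≈ 0#
    top _ ≡.refl = trans (coeff-X*-suc p (suc d)) (bound P (suc d) ℕ.≤-refl)
    mirror′ : ∀ i j → i ℕ.+ j ≡ 2 ℕ.+ d → coeff (X *ᵖ p) i ≈ coeff (X *ᵖ p) j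
    mirror′ zero    j       e = trans (coeff-X*-zero p) (sym (top j e))
    mirror′ (suc i) zero    e = trans (top (suc i) (≡.trans (≡.sym (ℕ.+-identityʳ _)) e)) (sym (coeff-X*-zero p))
    mirror′ (suc i) (suc j) e = trans (coeff-X*-suc p i)
      (trans (mirror P i j (ℕ.suc-injective (≡.trans (≡.sym (ℕ.+-suc i j)) (ℕ.suc-injective e))))
        (sym (coeff-X*-suc p j)))

  palindromic-[1+X]* : ∀ {d p} → Palindromic d p → Palindromic (suc d) ((1ᵖ +ᵖ X) *ᵖ p)
  palindromic-[1+X]* {d} {p} P = record
    { mirror = mirror′
    ; bound  = λ { (suc k) d<k → trans (coeff-suc k)
        (trans (+-cong (bound P (suc k) (ℕ.<-trans (ℕ.n<1+n d) d<k)) (bound P k (s≤s⁻¹ d<k)))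
          (+-identityˡ 0#)) }
    }
    where
    q = (1ᵖ +ᵖ X) *ᵖ p
    coeff-q : ∀ k → coeff q k ≈ coeff p k + coeff (X *ᵖ p) k
    coeff-q k = trans (ᴾ.distribʳ p 1ᵖ X k) (trans (coeff-+ (1ᵖ *ᵖ p) (X *ᵖ p) k) (+-congʳ (ᴾ.*-identityˡ p k)))
    coeff-zero : coeff q 0 ≈ coeff p 0
    coeff-zero = trans (coeff-q 0) (trans (+-congˡ (coeff-X*-zero p)) (+-identityʳ _))
    coeff-suc : ∀ k → coeff q (suc k) ≈ coeff p (suc k) + coeff p k
    coeff-suc k = trans (coeff-q (suc k)) (+-congˡ (coeff-X*-suc p k))
    top : ∀ j → j ≡ suc d → coeff q 0 ≈ coeff q j
    top _ ≡.refl = begin⟨ setoid ⟩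
      coeff q 0                 ≈⟨ coeff-zero ⟩
      coeff p 0                 ≈⟨ mirror P 0 d ≡.refl ⟩
      coeff p d                 ≈⟨ +-identityˡ _ ⟨
      0# + coeff p d            ≈⟨ +-congʳ (bound P (suc d) ℕ.≤-refl) ⟨
      coeff p (suc d) + coeff p d ≈⟨ coeff-suc d ⟨
      coeff q (suc d)           ∎
    mirror′ : ∀ i j → i ℕ.+ j ≡ suc d → coeff q i ≈ coeff q j
    mirror′ zero    j       e = top j e
    mirror′ (suc i) zero    e = sym (top (suc i) (≡.trans (≡.sym (ℕ.+-identityʳ _)) e))
    mirror′ (suc i) (suc j) e = begin⟨ setoid ⟩
      coeff q (suc i)             ≈⟨ coeff-suc i ⟩
      coeff p (suc i) + coeff p i
        ≈⟨ +-cong (mirror P (suc i) j (≡.trans (≡.sym (ℕ.+-suc i j)) (ℕ.suc-injective e)))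
                  (mirror P i (suc j) (ℕ.suc-injective e)) ⟩
      coeff p j + coeff p (suc j) ≈⟨ +-comm _ _ ⟩
      coeff p (suc j) + coeff p j ≈⟨ coeff-suc j ⟨
      coeff q (suc j)             ∎

  palindromic-1 : Palindromic 0 1ᵖ
  palindromic-1 = record
    { mirror = λ { zero zero _ → refl }
    ; bound  = λ { (suc k) _ → refl }
    }

  -- The odd part with exponent m is symmetric about (m - 1)/2, hence the shifted index. At m = 0 it
  -- is zero, and `X*odd-palindromic` treats that case separately.
  even-palindromic : ∀ m → Palindromic m (even (1ᵖ +ᵖ X) X m)
  odd-palindromic  : ∀ m → Palindromic m (odd (1ᵖ +ᵖ X) X (suc m))
  X*odd-palindromic : ∀ m → Palindromic (suc m) (X *ᵖ odd (1ᵖ +ᵖ X) X m)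
  even-palindromic zero    = palindromic-1
  even-palindromic (suc m) =
    palindromic-+ (palindromic-[1+X]* (even-palindromic m)) (X*odd-palindromic m)
  odd-palindromic zero    = palindromic-+ {p = (1ᵖ +ᵖ X) *ᵖ 0ᵖ} record
    { mirror = λ i j _ → trans (ᴾ.zeroʳ (1ᵖ +ᵖ X) i) (sym (ᴾ.zeroʳ (1ᵖ +ᵖ X) j))
    ; bound  = λ k _ → (ᴾ.zeroʳ (1ᵖ +ᵖ X)) k
    } palindromic-1
  odd-palindromic (suc m) =
    palindromic-+ (palindromic-[1+X]* (odd-palindromic m)) (even-palindromic (suc m))
  X*odd-palindromic zero    = record
    { mirror = λ i j _ → trans (ᴾ.zeroʳ X i) (sym (ᴾ.zeroʳ X j))
    ; bound  = λ k _ → (ᴾ.zeroʳ X) k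
    }
  X*odd-palindromic (suc m) = palindromic-X* (odd-palindromic m)

  -- Coefficient k of the reciprocal comes from the single index d ∸ k, and from no index when k
  -- exceeds d.
  palindromic⇒reciprocal : ∀ {d p} → Palindromic d p → p ≈ᵖ reciprocal d p
  palindromic⇒reciprocal {d} {p} P k = sym (begin⟨ setoid ⟩
    coeff (reciprocal d p) k
      ≈⟨ reflexive (≡.cong (λ q → coeff q k) (∑ᴸ-upTo (suc d) (λ i → coeff p i · X ^ (d ∸ i)))) ⟩
    coeff (∑< (suc d) (λ i → coeff p i · X ^ (d ∸ i))) k
      ≈⟨ coeff-∑< (suc d) (λ i → coeff p i · X ^ (d ∸ i)) k ⟩
    ∑<ᴿ (suc d) (λ i → coeff (coeff p i · X ^ (d ∸ i)) k)
      ≈⟨ selected ⟩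
    coeff p k ∎)
    where
    selected : ∑<ᴿ (suc d) (λ i → coeff (coeff p i · X ^ (d ∸ i)) k) ≈ coeff p k
    selected with k ℕ.≤? d
    ... | no  k≰d = trans
      (∑<ᴿ-zero (suc d) (λ i _ → coeff-monomial-other (coeff p i) (d ∸ i)
        (λ e → k≰d (≡.subst (_≤ d) e (ℕ.m∸n≤m d i)))))
      (sym (bound P k (ℕ.≰⇒> k≰d)))
    ... | yes k≤d = trans
      (∑<ᴿ-single (suc d) (d ∸ k) (s≤s (ℕ.m∸n≤m d k)) (λ i i≤d i≢d∸k →
        coeff-monomial-other (coeff p i) (d ∸ i) {k}
          (λ (e : d ∸ i ≡ k) → i≢d∸k
            (≡.trans (≡.sym (ℕ.m∸[m∸n]≡n (s≤s⁻¹ i≤d))) (≡.cong (d ∸_) e)))))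
      (trans (reflexive (≡.cong (λ j → coeff (coeff p (d ∸ k) · X ^ j) k) (ℕ.m∸[m∸n]≡n k≤d)))
        (trans (coeff-monomial-same (coeff p (d ∸ k)) k)
          (mirror P (d ∸ k) k (ℕ.m∸n+n≡m k≤d))))

  -- By symmetry this is also the coefficient of tᵐ, which makes m the exact degree.
  coeff-even-zero : ∀ m → coeff (even (1ᵖ +ᵖ X) X m) 0 ≈ 1#
  coeff-even-zero zero    = refl
  coeff-even-zero (suc m) = begin⟨ setoid ⟩
    coeff ((1ᵖ +ᵖ X) *ᵖ e +ᵖ X *ᵖ o) 0
      ≈⟨ coeff-+ ((1ᵖ +ᵖ X) *ᵖ e) (X *ᵖ o) 0 ⟩
    coeff ((1ᵖ +ᵖ X) *ᵖ e) 0 + coeff (X *ᵖ o) 0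
      ≈⟨ +-cong (trans (ᴾ.distribʳ e 1ᵖ X 0) (coeff-+ (1ᵖ *ᵖ e) (X *ᵖ e) 0)) (coeff-X*-zero o) ⟩
    coeff (1ᵖ *ᵖ e) 0 + coeff (X *ᵖ e) 0 + 0#
      ≈⟨ trans (+-identityʳ _) (+-cong (ᴾ.*-identityˡ e 0) (coeff-X*-zero e)) ⟩
    coeff e 0 + 0#
      ≈⟨ trans (+-identityʳ _) (coeff-even-zero m) ⟩
    1# ∎
    where
    e = even (1ᵖ +ᵖ X) X m
    o = odd (1ᵖ +ᵖ X) X m

  even-isGammaPolynomial : 1# ≉ 0# → ∀ m →
    IsGammaPolynomial (even (1ᵖ +ᵖ X) X m) (evenBinomials m)
  even-isGammaPolynomial 1≉0 m =
      m
    , ((λ e → 1≉0 (trans (sym (coeff-even-zero m)) (trans (mirror P 0 m ≡.refl) e))) , bound P)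
    , palindromic⇒reciprocal P
    , (λ k → sym (gammaExpansion-evenBinomials m k))
    , (λ i ⌊m/2⌋<i → trans (coeff-evenBinomials m i) (reflexive (≡.cong (_×ᴿ 1#)
        (⌊m/2⌋<k⇒mC2k≡0 m ⌊m/2⌋<i))))
    where P = even-palindromic m

-- Counting in filtered lists.

module FilteredLists where
  open ≡ using (refl; sym; trans; cong; cong₂; subst)
  open import Data.Nat.Base using (_+_)

  length-filter-map : {P : Pred B ℓp} (P? : Decidable P) (f : A → B) (xs : List A) →
    length (filter P? (map f xs)) ≡ length (filter (P? ∘ f) xs)
  length-filter-map P? f []       = refl
  length-filter-map P? f (x ∷ xs) with P? (f x)
  ... | yes _ = cong suc (length-filter-map P? f xs)
  ... | no  _ = length-filter-map P? f xs

  length-filter-allFin : {P : Pred (Fin (suc n)) ℓp} (P? : Decidable P) →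
    length (filter P? (allFin (suc n))) ≡
    length (filter P? (zero ∷ [])) + length (filter (P? ∘ suc) (allFin n))
  length-filter-allFin {n} P? with P? zero
  ... | yes _ = cong suc (trans (cong (length ∘ filter P?) (sym (map-tabulate {n = n} id suc)))
                                (length-filter-map P? suc (allFin n)))
  ... | no  _ = trans (cong (length ∘ filter P?) (sym (map-tabulate {n = n} id suc)))
                      (length-filter-map P? suc (allFin n))

  length-─ : {xs : List A} {x : A} (x∈xs : x ∈ xs) → suc (length (xs ─ x∈xs)) ≡ length xs
  length-─ (here refl)  = refl
  length-─ (there x∈xs) = cong suc (length-─ x∈xs)

  ∈-─ : {xs : List A} {x y : A} (x∈xs : x ∈ xs) → y ∈ xs → x ≢ y → y ∈ (xs ─ x∈xs)
  ∈-─ (here refl)  (here refl)  x≢y = contradiction refl x≢y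
  ∈-─ (here refl)  (there y∈xs) x≢y = y∈xs
  ∈-─ (there x∈xs) (here refl)  x≢y = here refl
  ∈-─ (there x∈xs) (there y∈xs) x≢y = there (∈-─ x∈xs y∈xs x≢y)

  -- Pigeonhole by deletion: the head of xs is removed from ys, and uniqueness keeps the other
  -- members of xs among what remains.
  unique-⊆⇒length≤ : {xs ys : List A} → Unique xs → (∀ {z} → z ∈ xs → z ∈ ys) →
    length xs ≤ length ys
  unique-⊆⇒length≤ {xs = []}     _           xs⊆ys = z≤n
  unique-⊆⇒length≤ {xs = x ∷ xs} (x∉xs ∷ xs!) xs⊆ys =
    subst (_ ≤_) (length-─ x∈ys) (s≤s (unique-⊆⇒length≤ xs! λ z∈xs →
      ∈-─ x∈ys (xs⊆ys (there z∈xs)) (ListAll.lookup x∉xs z∈xs)))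
    where x∈ys = xs⊆ys (here refl)

  unique-≐⇒↭ : {xs ys : List A} → Unique xs → Unique ys → (∀ {z} → z ∈ xs ⇔ z ∈ ys) → xs ↭ ys
  unique-≐⇒↭ xs! ys! xs≐ys = ∼bag⇒↭ (unique∧set⇒bag xs! ys! xs≐ys)

  length-filter-none : {P : Pred A ℓp} (P? : Decidable P) (xs : List A) → (∀ x → ¬ P x) →
    length (filter P? xs) ≡ 0
  length-filter-none P? xs ¬P = cong length (filter-none P? (ListAll.universal ¬P xs))

  length-filter-vectors-∷ : {P : Pred (Vec A (suc m)) ℓp} (P? : Decidable P) (x : A) (xs : List A) (vs : List (Vec A m)) →
    length (filter P? (cartesianProductWith _∷_ (x ∷ xs) vs)) ≡
    length (filter (P? ∘ (x ∷_)) vs) + length (filter P? (cartesianProductWith _∷_ xs vs))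
  length-filter-vectors-∷ P? x xs vs = begin
    length (filter P? (map (x ∷_) vs ++ cartesianProductWith _∷_ xs vs))
      ≡⟨ cong length (filter-++ P? (map (x ∷_) vs) _) ⟩
    length (filter P? (map (x ∷_) vs) ++ filter P? (cartesianProductWith _∷_ xs vs))
      ≡⟨ length-++ (filter P? (map (x ∷_) vs)) ⟩
    length (filter P? (map (x ∷_) vs)) + length (filter P? (cartesianProductWith _∷_ xs vs))
      ≡⟨ cong (_+ _) (length-filter-map P? (x ∷_) vs) ⟩
    length (filter (P? ∘ (x ∷_)) vs) + length (filter P? (cartesianProductWith _∷_ xs vs)) ∎
    where open ≡.≡-Reasoning

  length-filter-vectors-none : {P : Pred (Vec A (suc m)) ℓp} (P? : Decidable P) (xs : List A) (vs : List (Vec A m)) →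
    ListAll.All (λ x → ∀ v → ¬ P (x ∷ v)) xs →
    length (filter P? (cartesianProductWith _∷_ xs vs)) ≡ 0
  length-filter-vectors-none P? []       vs _           = refl
  length-filter-vectors-none P? (x ∷ xs) vs (¬Px ∷ ¬Ps) = trans (length-filter-vectors-∷ P? x xs vs)
    (cong₂ _+_ (length-filter-none (P? ∘ (x ∷_)) vs ¬Px) (length-filter-vectors-none P? xs vs ¬Ps))

  -- Families such as `𝒩` and the selected Motzkin paths are filters of filters of `vectors`;
  -- recursion on vectors wants a single predicate.
  filter-filter : {P : Pred A ℓp} {Q : Pred A ℓq} {ℓ : Level} {S : Pred A ℓ}
    (P? : Decidable P) (Q? : Decidable Q) (S? : Decidable S) →
    (∀ {x} → S x → P x × Q x) → (∀ {x} → P x → Q x → S x) →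
    ∀ xs → filter P? (filter Q? xs) ≡ filter S? xs
  filter-filter P? Q? S? S⇒ ⇒S []       = refl
  filter-filter P? Q? S? S⇒ ⇒S (x ∷ xs) with Q? x
  ... | no ¬Qx = trans (filter-filter P? Q? S? S⇒ ⇒S xs) (sym (filter-reject S? (¬Qx ∘ proj₂ ∘ S⇒)))
  ... | yes Qx with P? x
  ...   | no ¬Px = trans (filter-filter P? Q? S? S⇒ ⇒S xs) (sym (filter-reject S? (¬Px ∘ proj₁ ∘ S⇒)))
  ...   | yes Px = trans (cong (x ∷_) (filter-filter P? Q? S? S⇒ ⇒S xs)) (sym (filter-accept S? (⇒S Px Qx)))

-- Peak-cliques of an area sequence and a local form of the nesting condition.

module CliquesOfAreaSequences where
  open ≡ using (refl; sym; trans; cong; subst)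
  open import Data.Nat.Base using (_+_)
  open import Defs
  open FilteredLists

  fin : ∀ {k} → k < n → ∃[ i ] toℕ {n} i ≡ k
  fin k<n = fromℕ< k<n , Fin.toℕ-fromℕ< k<n

  -- The right end of a peak-clique: with bᵢ = i - aᵢ, a vertex i which is the
  -- last one or satisfies bᵢ < bᵢ₊₁.
  End : Vec ℕ n → Fin n → Set
  End (x ∷ w)     (suc i) = End w i
  End (x ∷ [])    zero    = ⊤
  End (x ∷ y ∷ w) zero    = y ≤ x

  end? : (w : Vec ℕ n) → Decidable (End w)
  end? (x ∷ w)     (suc i) = end? w i
  end? (x ∷ [])    zero    = yes tt
  end? (x ∷ y ∷ w) zero    = y ℕ.≤? x

  -- `End` recurses along the vector so that `ends` can be counted from the left; this lemma and the
  -- next translate it into positions, in which arcs are expressed.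
  end-next : (w : Vec ℕ n) (i j : Fin n) → toℕ j ≡ suc (toℕ i) → End w i → lookup w j ≤ lookup w i
  end-next (x ∷ y ∷ w) zero    (suc zero) _ end = end
  end-next (x ∷ w)     (suc i) (suc j)    e end = end-next w i j (ℕ.suc-injective e) end

  next⇒end : (w : Vec ℕ n) (i : Fin n) →
    (∀ j → toℕ j ≡ suc (toℕ i) → lookup w j ≤ lookup w i) → End w i
  next⇒end (x ∷ [])    zero    _    = tt
  next⇒end (x ∷ y ∷ w) zero    next = next (suc zero) refl
  next⇒end (x ∷ w)     (suc i) next = next⇒end w i (λ j e → next (suc j) (cong suc e))

  ends : Vec ℕ n → ℕ
  ends {n} w = length (filter (end? w) (allFin n))

  ends-stay : ∀ x y (w : Vec ℕ n) → ¬ y ≤ x → ends (x ∷ y ∷ w) ≡ ends (y ∷ w)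
  ends-stay x y w y≰x = trans (length-filter-allFin (end? (x ∷ y ∷ w)))
    (cong (λ l → length l + ends (y ∷ w)) (filter-reject (end? (x ∷ y ∷ w)) {zero} {[]} y≰x))

  ends-jump : ∀ x y (w : Vec ℕ n) → y ≤ x → ends (x ∷ y ∷ w) ≡ suc (ends (y ∷ w))
  ends-jump x y w y≤x = trans (length-filter-allFin (end? (x ∷ y ∷ w)))
    (cong (λ l → length l + ends (y ∷ w)) (filter-accept (end? (x ∷ y ∷ w)) {zero} {[]} y≤x))

  module AreaSequence (a : Vec ℕ n) (isArea : IsAreaSequence a) where

    a≤ : ∀ i → lookup a i ≤ toℕ i
    a≤ i = s≤s⁻¹ (proj₁ isArea i)

    left : Fin n → ℕ
    left i = toℕ i ∸ lookup a i

    left≤ : ∀ i → left i ≤ toℕ i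
    left≤ i = ℕ.m∸n≤m (toℕ i) (lookup a i)

    left-next : ∀ i j → toℕ j ≡ suc (toℕ i) → left i ≤ left j
    left-next i j j≡1+i rewrite j≡1+i =
      ℕ.∸-monoʳ-≤ (suc (toℕ i)) (proj₂ isArea i j j≡1+i)

    left-mono : ∀ i j → toℕ i ≤ toℕ j → left i ≤ left j
    left-mono i j i≤j = go (toℕ j ∸ toℕ i) j (sym (ℕ.m∸n+n≡m i≤j))
      where
      go : ∀ d j → toℕ j ≡ d + toℕ i → left i ≤ left j
      go zero    j e rewrite Fin.toℕ-injective e = ℕ.≤-refl
      go (suc d) j e with k , k≡ ← fin (ℕ.<-trans (ℕ.n<1+n (d + toℕ i)) (subst (_< n) e (Fin.toℕ<n j))) =
        ℕ.≤-trans (go d k k≡) (left-next k j (trans e (cong suc (sym k≡))))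

    -- Because bᵢ₊₁ - bᵢ = 1 + aᵢ - aᵢ₊₁; by `a≤` the subtraction i ∸ aᵢ is not truncated.
    end⇒left< : ∀ i j → toℕ j ≡ suc (toℕ i) → End a i → left i < left j
    end⇒left< i j j≡1+i end rewrite j≡1+i = ℕ.<-≤-trans
      (ℕ.≤-reflexive (sym (ℕ.+-∸-assoc 1 (a≤ i))))
      (ℕ.∸-monoʳ-≤ (suc (toℕ i)) (end-next a i j j≡1+i end))

    left<⇒end : ∀ i → (∀ j → toℕ j ≡ suc (toℕ i) → left i < left j) → End a i
    left<⇒end i left< = next⇒end a i λ j j≡1+i → ℕ.≮⇒≥ λ aᵢ<aⱼ →
      ℕ.<⇒≱ (left< j j≡1+i)
        (subst (λ k → k ∸ lookup a j ≤ left i) (sym j≡1+i) (ℕ.∸-monoʳ-≤ (suc (toℕ i)) aᵢ<aⱼ))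

    end⇒left<′ : ∀ i j → toℕ i < toℕ j → End a i → left i < left j
    end⇒left<′ i j i<j end with k , k≡ ← fin (ℕ.≤-<-trans i<j (Fin.toℕ<n j)) =
      ℕ.<-≤-trans (end⇒left< i k k≡ end) (left-mono k j (subst (_≤ toℕ j) (sym k≡) i<j))

    pred-fin : ∀ (i : Fin n) {k} → k < toℕ i → ∃[ j ] toℕ i ≡ suc (toℕ {n} j) × k ≤ toℕ j
    pred-fin i {k} k<i = j , i≡1+j , s≤s⁻¹ (subst (k <_) i≡1+j k<i)
      where
      instance _ = ℕ.>-nonZero (ℕ.≤-<-trans z≤n k<i)
      pred<n : ℕ.pred (toℕ i) < n
      pred<n = ℕ.<-trans (ℕ.≤-reflexive (ℕ.suc-pred (toℕ i))) (Fin.toℕ<n i)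
      j = proj₁ (fin pred<n)
      i≡1+j : toℕ i ≡ suc (toℕ j)
      i≡1+j = sym (trans (cong suc (proj₂ (fin pred<n))) (ℕ.suc-pred (toℕ i)))

    -- If bⱼ were less than i, then i - 1 would be adjacent to j; if bⱼ₊₁ were at most i, then i
    -- would be adjacent to j + 1. For an isolated vertex the same holds with j = i.
    peak⇒ : ∀ {i j} → IsPeakEdge a (i , j) → toℕ i ≡ left j × End a j
    peak⇒ {i} (inj₁ (refl , isolated)) =
        ℕ.≤-antisym
          (ℕ.≮⇒≥ λ left<i → let j , i≡1+j , left≤j = pred-fin i left<i in
            isolated j (inj₂ (ℕ.≤-reflexive (sym i≡1+j) , left≤j)))
          (left≤ i)
      , left<⇒end i λ j j≡1+i → ℕ.≤-<-trans (left≤ i) (ℕ.≰⇒> λ left≤i →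
          isolated j (inj₁ (ℕ.≤-reflexive (sym j≡1+i) , left≤i)))
    peak⇒ {i} {j} (inj₂ (i<j , inj₂ (j<i , _) , _ , _)) = contradiction i<j (ℕ.<-asym j<i)
    peak⇒ {i} {j} (inj₂ (i<j , inj₁ (_ , left≤i) , maxʳ , maxˡ)) =
        ℕ.≤-antisym
          (ℕ.≮⇒≥ λ left<i → let k , i≡1+k , left≤k = pred-fin i left<i in
            maxˡ k i≡1+k (inj₁ (ℕ.<-trans (ℕ.≤-reflexive (sym i≡1+k)) i<j , left≤k)))
          left≤i
      , left<⇒end j λ k k≡1+j → ℕ.≤-<-trans left≤i (ℕ.≰⇒> λ left≤i →
          maxʳ k k≡1+j (inj₁ (ℕ.<-trans i<j (ℕ.≤-reflexive (sym k≡1+j)) , left≤i)))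

    -- The case i < j gives an edge and i = j an isolated vertex. The latter must exclude every
    -- later neighbour, not only the next one, which is where monotonicity of `left` enters.
    peak⇐ : ∀ {i j} → toℕ i ≡ left j → End a j → IsPeakEdge a (i , j)
    peak⇐ {i} {j} i≡left end with ℕ.m≤n⇒m<n∨m≡n (subst (_≤ toℕ j) (sym i≡left) (left≤ j))
    ... | inj₁ i<j = inj₂
      ( i<j
      , inj₁ (i<j , ℕ.≤-reflexive (sym i≡left))
      , (λ { k k≡1+j (inj₁ (_ , left≤i)) →
               ℕ.<⇒≱ (end⇒left< j k k≡1+j end) (subst (left k ≤_) i≡left left≤i)
           ; k k≡1+j (inj₂ (k<i , _)) →
               ℕ.<-asym i<j (ℕ.<-trans (ℕ.≤-reflexive (sym k≡1+j)) k<i) })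
      , (λ { k i≡1+k (inj₁ (_ , left≤k)) →
               ℕ.<⇒≱ (ℕ.≤-reflexive (sym i≡1+k)) (subst (_≤ toℕ k) (sym i≡left) left≤k)
           ; k i≡1+k (inj₂ (j<k , _)) →
               ℕ.<-asym i<j (ℕ.<-trans j<k (ℕ.≤-reflexive (sym i≡1+k))) }))
    ... | inj₂ i≡j with refl ← Fin.toℕ-injective i≡j = inj₁
      ( refl
      , (λ { k (inj₁ (i<k , left≤i)) →
               ℕ.<⇒≱ (end⇒left<′ i k i<k end) (subst (left k ≤_) i≡left left≤i)
           ; k (inj₂ (k<i , left≤k)) → ℕ.<⇒≱ k<i (subst (_≤ toℕ k) (sym i≡left) left≤k) }))

    leftEnd : Fin n → Fin n
    leftEnd j = fromℕ< (ℕ.≤-<-trans (left≤ j) (Fin.toℕ<n j))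

    toℕ-leftEnd : ∀ j → toℕ (leftEnd j) ≡ left j
    toℕ-leftEnd j = Fin.toℕ-fromℕ< _

    -- A peak-edge is determined by its right end. Only lengths of these lists and of their filters
    -- are compared later, so a permutation suffices.
    peakEdges↭ends : peakEdges a ↭ map (λ j → leftEnd j , j) (filter (end? a) (allFin n))
    peakEdges↭ends = unique-≐⇒↭
      (Unique.filter⁺ (isPeakEdge? a) (Unique.cartesianProduct⁺ (Unique.allFin⁺ n) (Unique.allFin⁺ n)))
      (Unique.map⁺ (cong proj₂) (Unique.filter⁺ (end? a) (Unique.allFin⁺ n)))
      (mk⇔ to from)
      where
      to : ∀ {e} → e ∈ peakEdges a → e ∈ map (λ j → leftEnd j , j) (filter (end? a) (allFin n))
      to {i , j} e∈ with i≡left , end ← peak⇒ (proj₂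
        (∈-filter⁻ (isPeakEdge? a) {xs = cartesianProduct (allFin n) (allFin n)} e∈)) =
        subst (λ i → (i , j) ∈ _) (Fin.toℕ-injective (trans (toℕ-leftEnd j) (sym i≡left)))
          (∈-map⁺ _ (∈-filter⁺ (end? a) (∈-allFin j) end))
      from : ∀ {e} → e ∈ map (λ j → leftEnd j , j) (filter (end? a) (allFin n)) → e ∈ peakEdges a
      from e∈ with j , j∈ , refl ← ∈-map⁻ (λ j → leftEnd j , j) e∈ =
        ∈-filter⁺ (isPeakEdge? a) (∈-cartesianProduct⁺ (∈-allFin _) (∈-allFin _))
          (peak⇐ (toℕ-leftEnd j) (proj₂ (∈-filter⁻ (end? a) {xs = allFin n} j∈)))

    peak≡ends : peak a ≡ ends a
    peak≡ends = trans (↭-length peakEdges↭ends) (length-map (λ j → leftEnd j , j) (filter (end? a) (allFin n)))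

    covers? : (v : Fin n) → Decidable (λ (j : Fin n) → leftEnd j Fin.≤ v × v Fin.≤ j)
    covers? v j = (leftEnd j Fin.≤? v) ×-dec (v Fin.≤? j)

    covering : Fin n → List (Fin n)
    covering v = filter (covers? v) (filter (end? a) (allFin n))

    peakNesting≡ : ∀ v → peakNesting a v ≡ length (covering v)
    peakNesting≡ v = trans (↭-length (filter-↭ _ peakEdges↭ends)) (length-filter-map _ _ (filter (end? a) (allFin n)))

    ∈-covering : ∀ v {j} → End a j → left j ≤ toℕ v → toℕ v ≤ toℕ j → j ∈ covering v
    ∈-covering v {j} end left≤v v≤j = ∈-filter⁺ (covers? v) (∈-filter⁺ (end? a) (∈-allFin j) end)
      (subst (_≤ toℕ v) (sym (toℕ-leftEnd j)) left≤v , v≤j)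

    covering-end : ∀ v {j} → j ∈ covering v → End a j × left j ≤ toℕ v × toℕ v ≤ toℕ j
    covering-end v {j} j∈ with j∈ends , (l , r) ← ∈-filter⁻ (covers? v) {xs = filter (end? a) (allFin n)} j∈ =
      proj₂ (∈-filter⁻ (end? a) {xs = allFin n} j∈ends) , subst (_≤ toℕ v) (toℕ-leftEnd j) l , r

    covering-sorted : ∀ v → AllPairs Fin._<_ (covering v)
    covering-sorted v = AllPairs.filter⁺ (covers? v) (AllPairs.filter⁺ (end? a) (AllPairs.tabulate⁺-< id))

    -- Among three consecutive peak-cliques, the third starts after the first has ended.
    Separated : Set
    Separated = ∀ s p k → s Fin.< p → p Fin.< k → End a s → End a p → toℕ s < left k

    -- If three ends s < p < k had cliques through v, then left k ≤ v ≤ s, against separation.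
    separated⇒pnest≤2 : Separated → pnest a ≤ 2
    separated⇒pnest≤2 sep = max≤v⁺ z≤n (ListAll.map⁺ (ListAll.universal (λ v →
      subst (_≤ 2) (sym (peakNesting≡ v)) (short v (covering v) refl)) (allFin n)))
      where
      short : ∀ v xs → covering v ≡ xs → length xs ≤ 2
      short v []              _  = z≤n
      short v (_ ∷ [])        _  = s≤s z≤n
      short v (_ ∷ _ ∷ [])    _  = s≤s (s≤s z≤n)
      short v (s ∷ p ∷ k ∷ xs) eq with subst (AllPairs Fin._<_) eq (covering-sorted v)
      ... | (s<p ∷ _) ∷ (p<k ∷ _) ∷ _ =
        let member : ∀ {j} → j ∈ s ∷ p ∷ k ∷ xs → End a j × left j ≤ toℕ v × toℕ v ≤ toℕ j
            member j∈ = covering-end v (subst (_ ∈_) (sym eq) j∈)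
            end-s , _ , v≤s = member (here refl)
            end-p , _       = member (there (here refl))
            _ , left≤v , _  = member (there (there (here refl)))
        in contradiction (ℕ.≤-trans left≤v v≤s) (ℕ.<⇒≱ (sep s p k s<p p<k end-s end-p))

    -- `Separated` speaks of every vertex k, whereas nesting counts cliques only; a run of vertices
    -- with the same left endpoint closes with an end.
    end-of-block : ∀ k → ∃[ j ] toℕ k ≤ toℕ j × End a j × left j ≤ left k
    end-of-block k = go n k (ℕ.m≤m+n n (toℕ k))
      where
      -- The fuel d bounds the number of vertices from k on.
      go : ∀ d k → n ≤ d + toℕ k → ∃[ j ] toℕ k ≤ toℕ j × End a j × left j ≤ left k
      go zero    k n≤k = contradiction n≤k (ℕ.<⇒≱ (Fin.toℕ<n k))
      go (suc d) k n≤d+k with end? a k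
      ... | yes end = k , ℕ.≤-refl , end , ℕ.≤-refl
      ... | no ¬end with Fin.any? (λ j → (toℕ j ℕ.≟ suc (toℕ k)) ×-dec (left j ℕ.≤? left k))
      ...   | no  ∄j = contradiction
              (left<⇒end k (λ j j≡1+k → ℕ.≰⇒> λ left≤ → ∄j (j , j≡1+k , left≤))) ¬end
      ...   | yes (j , j≡1+k , leftj≤) =
              let i , j≤i , end , lefti≤ = go d j (subst (n ≤_)
                    (trans (sym (ℕ.+-suc d (toℕ k))) (cong (d +_) (sym j≡1+k))) n≤d+k)
              in i , ℕ.≤-trans (ℕ.<⇒≤ (ℕ.≤-reflexive (sym j≡1+k))) j≤i , end , ℕ.≤-trans lefti≤ leftj≤

    -- The offending vertex is s itself: if left k ≤ s, it lies in the cliques ending at s, at p and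
    -- at the end of the block of k.
    pnest≤2⇒separated : pnest a ≤ 2 → Separated
    pnest≤2⇒separated pnest≤2 s p k s<p p<k end-s end-p = ℕ.≰⇒> λ left-k≤s →
      let j , k≤j , end-j , left-j≤ = end-of-block k
          p<j = ℕ.<-≤-trans p<k k≤j
          distinct : Unique (s ∷ p ∷ j ∷ [])
          distinct = (Fin.<⇒≢ s<p ∷ Fin.<⇒≢ (ℕ.<-trans s<p p<j) ∷ []) ∷ (Fin.<⇒≢ p<j ∷ []) ∷ [] ∷ []
          cover-s = ∈-covering s end-s (left≤ s) ℕ.≤-refl
          cover-p = ∈-covering s end-p (ℕ.≤-trans (left-mono p k (ℕ.<⇒≤ p<k)) left-k≤s) (ℕ.<⇒≤ s<p)
          cover-j = ∈-covering s end-j (ℕ.≤-trans left-j≤ left-k≤s) (ℕ.<⇒≤ (ℕ.<-trans s<p p<j))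
          3≤length : 3 ≤ length (covering s)
          3≤length = unique-⊆⇒length≤ distinct λ
            { (here refl) → cover-s ; (there (here refl)) → cover-p ; (there (there (here refl))) → cover-j }
          length≤2 : length (covering s) ≤ 2
          length≤2 = subst (_≤ 2) (peakNesting≡ s)
            (ℕ.≤-trans (ListAll.lookup (ListAll.map⁻ (xs≤max 0 (map (peakNesting a) (allFin n))))
              (∈-allFin s)) pnest≤2)
      in contradiction length≤2 (ℕ.<⇒≱ 3≤length)

  -- Scanning an area sequence from left to right, x is the current entry aᵢ and e
  -- is the distance from i back to the last end before i: a new left endpoint
  -- i + 1 - y has to lie strictly to the right of both.
  Nested₂ : ℕ → Vec ℕ (suc m) → Set
  Nested₂ e (x ∷ [])    = ⊤
  Nested₂ e (x ∷ y ∷ w) =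
    (y ≡ suc x × Nested₂ (suc e) (y ∷ w)) ⊎ (y ≤ x × y ≤ e × Nested₂ 1 (y ∷ w))

  -- `Nested₂` in terms of positions, with sums in place of truncated subtractions. Counting from
  -- the current vertex as 0, the last end before it sits at -e: `first` says that a left endpoint k
  -- - wₖ beyond some end of w exceeds -e, and `later` is `Separated` within w.
  record Spaced (e : ℕ) (w : Vec ℕ (suc m)) : Set where
    constructor spaced
    field
      step  : ∀ i j → toℕ j ≡ suc (toℕ i) → lookup w j ≤ suc (lookup w i)
      first : ∀ p k → p Fin.< k → End w p → lookup w k < toℕ k + e
      later : ∀ s p k → s Fin.< p → p Fin.< k → End w s → End w p → lookup w k + toℕ s < toℕ k

  open Spaced

  -- Left endpoints never move back, so the bound y ≤ e at a jump, which `Nested₂` checks only once,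
  -- extends to all later vertices.
  entry≤ : (w : Vec ℕ (suc m)) → (∀ i j → toℕ j ≡ suc (toℕ i) → lookup w j ≤ suc (lookup w i)) →
    ∀ k → lookup w k ≤ toℕ k + head w
  entry≤ (x ∷ w)     step zero    = ℕ.≤-refl
  entry≤ (x ∷ y ∷ w) step (suc k) = ℕ.≤-trans
    (entry≤ (y ∷ w) (λ i j e → step (suc i) (suc j) (cong suc e)) k)
    (ℕ.≤-trans (ℕ.+-monoʳ-≤ (toℕ k) (step zero (suc zero) refl)) (ℕ.≤-reflexive (ℕ.+-suc (toℕ k) x)))

  spaced⇒nested₂ : ∀ e (w : Vec ℕ (suc m)) → Spaced e w → Nested₂ e w
  spaced⇒nested₂ e (x ∷ [])    S = tt
  spaced⇒nested₂ e (x ∷ y ∷ w) S with y ℕ.≤? x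
  ... | no  y≰x = inj₁ (ℕ.≤-antisym (step S zero (suc zero) refl) (ℕ.≰⇒> y≰x)
                       , spaced⇒nested₂ (suc e) (y ∷ w) (spaced
    (λ i j j≡1+i → step S (suc i) (suc j) (cong suc j≡1+i))
    (λ p k p<k end → subst (lookup (y ∷ w) k <_) (sym (ℕ.+-suc (toℕ k) e))
      (first S (suc p) (suc k) (s≤s p<k) end))
    (λ s p k s<p p<k end-s end-p → s≤s⁻¹ (subst (_< suc (toℕ k)) (ℕ.+-suc _ (toℕ s))
      (later S (suc s) (suc p) (suc k) (s≤s s<p) (s≤s p<k) end-s end-p)))))
  ... | yes y≤x = inj₂ (y≤x , s≤s⁻¹ (first S zero (suc zero) z<s y≤x)
                       , spaced⇒nested₂ 1 (y ∷ w) (spaced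
    (λ i j j≡1+i → step S (suc i) (suc j) (cong suc j≡1+i))
    -- After the jump the vertex of x is the last end, at distance 1: `later` with s = `zero`
    -- becomes `first` for the tail.
    (λ p k p<k end → subst (lookup (y ∷ w) k <_) (ℕ.+-comm 1 (toℕ k))
      (subst (_< suc (toℕ k)) (ℕ.+-identityʳ _)
        (later S zero (suc p) (suc k) z<s (s≤s p<k) y≤x end)))
    (λ s p k s<p p<k end-s end-p → s≤s⁻¹ (subst (_< suc (toℕ k)) (ℕ.+-suc _ (toℕ s))
      (later S (suc s) (suc p) (suc k) (s≤s s<p) (s≤s p<k) end-s end-p)))))

  nested₂⇒spaced : ∀ e (w : Vec ℕ (suc m)) → Nested₂ e w → Spaced e w
  nested₂⇒spaced e (x ∷ [])    N = spaced
    (λ { zero zero () }) (λ { zero zero () _ }) (λ { zero zero _ () _ _ _ })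
  nested₂⇒spaced e (x ∷ y ∷ w) (inj₁ (y≡1+x , N)) = spaced step′ first′ later′
    where
    S = nested₂⇒spaced (suc e) (y ∷ w) N
    y≰x : ¬ y ≤ x
    y≰x = ℕ.<⇒≱ (ℕ.≤-reflexive (sym y≡1+x))
    step′ : ∀ i j → toℕ j ≡ suc (toℕ i) → lookup (x ∷ y ∷ w) j ≤ suc (lookup (x ∷ y ∷ w) i)
    step′ zero    (suc zero) _ = ℕ.≤-reflexive y≡1+x
    step′ (suc i) (suc j)    j≡1+i = step S i j (ℕ.suc-injective j≡1+i)
    first′ : ∀ p k → p Fin.< k → End (x ∷ y ∷ w) p → lookup (x ∷ y ∷ w) k < toℕ k + e
    first′ zero    k       _   y≤x = contradiction y≤x y≰x
    first′ (suc p) (suc k) p<k end =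
      subst (lookup (y ∷ w) k <_) (ℕ.+-suc (toℕ k) e) (first S p k (s≤s⁻¹ p<k) end)
    later′ : ∀ s p k → s Fin.< p → p Fin.< k → End (x ∷ y ∷ w) s → End (x ∷ y ∷ w) p →
      lookup (x ∷ y ∷ w) k + toℕ s < toℕ k
    later′ zero    p       k       _   _   y≤x   _     = contradiction y≤x y≰x
    later′ (suc s) (suc p) (suc k) s<p p<k end-s end-p =
      subst (_< suc (toℕ k)) (sym (ℕ.+-suc _ (toℕ s)))
        (s≤s (later S s p k (s≤s⁻¹ s<p) (s≤s⁻¹ p<k) end-s end-p))
  nested₂⇒spaced e (x ∷ y ∷ w) (inj₂ (y≤x , y≤e , N)) = spaced step′ first′ later′
    where
    S = nested₂⇒spaced 1 (y ∷ w) N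
    tail-first : ∀ p k → p Fin.< k → End (y ∷ w) p → lookup (y ∷ w) k < suc (toℕ k)
    tail-first p k p<k end = subst (lookup (y ∷ w) k <_) (ℕ.+-comm (toℕ k) 1) (first S p k p<k end)
    step′ : ∀ i j → toℕ j ≡ suc (toℕ i) → lookup (x ∷ y ∷ w) j ≤ suc (lookup (x ∷ y ∷ w) i)
    step′ zero    (suc zero) _ = ℕ.m≤n⇒m≤1+n y≤x
    step′ (suc i) (suc j)    j≡1+i = step S i j (ℕ.suc-injective j≡1+i)
    first′ : ∀ p k → p Fin.< k → End (x ∷ y ∷ w) p → lookup (x ∷ y ∷ w) k < toℕ k + e
    first′ zero    (suc k) _   _   =
      s≤s (ℕ.≤-trans (entry≤ (y ∷ w) (step S) k) (ℕ.+-monoʳ-≤ (toℕ k) y≤e))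
    first′ (suc p) (suc k) p<k end =
      ℕ.<-≤-trans (tail-first p k (s≤s⁻¹ p<k) end) (ℕ.m≤m+n (suc (toℕ k)) e)
    later′ : ∀ s p k → s Fin.< p → p Fin.< k → End (x ∷ y ∷ w) s → End (x ∷ y ∷ w) p →
      lookup (x ∷ y ∷ w) k + toℕ s < toℕ k
    later′ zero    (suc p) (suc k) _   p<k _     end-p =
      subst (_< suc (toℕ k)) (sym (ℕ.+-identityʳ _)) (tail-first p k (s≤s⁻¹ p<k) end-p)
    later′ (suc s) (suc p) (suc k) s<p p<k end-s end-p =
      subst (_< suc (toℕ k)) (sym (ℕ.+-suc _ (toℕ s)))
        (s≤s (later S s p k (s≤s⁻¹ s<p) (s≤s⁻¹ p<k) end-s end-p))

  𝒩₂⇒nested₂ : (a : Vec ℕ (suc m)) → IsAreaSequence a → pnest a ≤ 2 → head a ≡ 0 × Nested₂ 1 a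
  𝒩₂⇒nested₂ a@(x ∷ _) isArea pnest≤2 =
      ℕ.n≤0⇒n≡0 (s≤s⁻¹ (proj₁ isArea zero))
    , spaced⇒nested₂ 1 a (spaced (proj₂ isArea)
        -- With e = 1 a virtual end sits just before the first vertex, and `first` reduces to the
        -- bound on the entries of an area sequence.
        (λ _ k _ _ → subst (lookup a k <_) (ℕ.+-comm 1 (toℕ k)) (proj₁ isArea k))
        (λ s p k s<p p<k end-s end-p → subst (_≤ toℕ k) (cong suc (ℕ.+-comm (toℕ s) (lookup a k)))
          (ℕ.m≤o∸n⇒m+n≤o (suc (toℕ s)) (a≤ k) (pnest≤2⇒separated pnest≤2 s p k s<p p<k end-s end-p))))
    where open AreaSequence a isArea

  nested₂⇒𝒩₂ : (a : Vec ℕ (suc m)) → head a ≡ 0 → Nested₂ 1 a → IsAreaSequence a × pnest a ≤ 2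
  nested₂⇒𝒩₂ a@(x ∷ _) refl N = isArea , separated⇒pnest≤2 λ s p k s<p p<k end-s end-p →
    ℕ.m+n≤o⇒m≤o∸n (suc (toℕ s))
      (subst (_≤ toℕ k) (cong suc (ℕ.+-comm (lookup a k) (toℕ s))) (later S s p k s<p p<k end-s end-p))
    where
    S = nested₂⇒spaced 1 a N
    isArea : IsAreaSequence a
    isArea = (λ i → s≤s (subst (lookup a i ≤_) (ℕ.+-identityʳ (toℕ i)) (entry≤ a (step S) i))) , step S
    open AreaSequence a isArea

-- The weighted count of nested sequences.

module WeightedSums {c ℓ} (R : CommutativeRing c ℓ) where
  open CommutativeRing R hiding (_-_)
  open Defs using (vectors)
  open CliquesOfAreaSequences using (Nested₂; ends; ends-stay; ends-jump)
  open EvenOddParts R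
  open Exp semiring using (_^_)
  open Solver commutativeSemiring using (solve; _:=_; _:+_; _:*_; con)
  open import Relation.Binary.Reasoning.Setoid setoid

  -- The contributions of the next entry x are assembled from two shapes: `indicator` for staying,
  -- at x = c + 1, and `below` for the jumps to 1 ≤ x ≤ q.
  indicator : ℕ → Carrier → ℕ → Carrier
  indicator zero    a zero    = a
  indicator zero    a (suc x) = 0#
  indicator (suc c) a zero    = 0#
  indicator (suc c) a (suc x) = indicator c a x

  below : ℕ → Carrier → ℕ → Carrier
  below zero    a x       = 0#
  below (suc q) a zero    = a
  below (suc q) a (suc x) = below q a x

  indicator-≡ : ∀ c a → indicator c a c ≈ a
  indicator-≡ zero    a = refl
  indicator-≡ (suc c) a = indicator-≡ c a

  indicator-≢ : ∀ c a x → x ≢ c → indicator c a x ≈ 0#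
  indicator-≢ zero    a zero    x≢c = contradiction ≡.refl x≢c
  indicator-≢ zero    a (suc x) x≢c = refl
  indicator-≢ (suc c) a zero    x≢c = refl
  indicator-≢ (suc c) a (suc x) x≢c = indicator-≢ c a x (x≢c ∘ ≡.cong suc)

  below-< : ∀ {q a x} → x < q → below q a x ≈ a
  below-< {suc q} {a} {zero}  _   = refl
  below-< {suc q} {a} {suc x} x<q = below-< (s≤s⁻¹ x<q)

  below-≥ : ∀ {q a x} → q ≤ x → below q a x ≈ 0#
  below-≥ {zero}                   _   = refl
  below-≥ {suc q} {a} {suc x} q≤x = below-≥ (s≤s⁻¹ q≤x)

  ∑<-indicator : ∀ n c a → c < n → ∑< n (indicator c a) ≈ a
  ∑<-indicator n c a c<n =
    trans (∑<-single n c c<n (λ x _ → indicator-≢ c a x)) (indicator-≡ c a)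

  fromℕ : ℕ → Carrier
  fromℕ zero    = 0#
  fromℕ (suc n) = 1# + fromℕ n

  ∑<-below : ∀ n q a → q ≤ n → ∑< n (below q a) ≈ fromℕ q * a
  ∑<-below n       zero    a _   = trans (∑<-zero n (λ _ _ → refl)) (sym (zeroˡ a))
  ∑<-below (suc n) (suc q) a q≤n = trans (+-congˡ (∑<-below n q a (s≤s⁻¹ q≤n)))
    (solve 2 (λ a k → a :+ k :* a := (con 1 :+ k) :* a) refl a _)

  module _ (t : Carrier) where

    private
      E O : ℕ → Carrier
      E = even (1# + t) t
      O = odd (1# + t) t

      endWeight : Vec ℕ (suc m) → Carrier
      endWeight w = t ^ ends w

    -- The outer t is the weight of the last vertex, which is always an end; m counts the entries
    -- still to be chosen.
    total : ℕ → ℕ → Carrier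
    total m q = t * (E m + fromℕ q * (t * O m))

    -- The summands are staying, the jump to entry 0, and the q jumps to positive entries. Comparing
    -- the parts free of q and linear in q gives the recursions of `even` and `odd` at u = 1 + t, x
    -- = t.
    total-suc : ∀ m q →
      total m (suc q) + (t * total m 0 + fromℕ q * (t * total m 1)) ≈ total (suc m) q
    total-suc m q = solve 4 (λ t e o k →
        t :* (e :+ (con 1 :+ k) :* (t :* o)) :+ (t :* (t :* (e :+ con 0 :* (t :* o)))
          :+ k :* (t :* (t :* (e :+ (con 1 :+ con 0) :* (t :* o)))))
        := t :* (((con 1 :+ t) :* e :+ t :* o) :+ k :* (t :* ((con 1 :+ t) :* o :+ e))))
      refl t (E m) (O m) (fromℕ q)

    -- The total weight of the continuations depends on the state only through
    -- the number c ⊓ e of vertices at which a new clique may start.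
    ∑-nested₂ : ∀ {N} m c e {P : Pred (Vec ℕ m) ℓp} (P? : Decidable P) → c ℕ.+ m < N →
      P ≐ (λ v → Nested₂ e (c ∷ v)) →
      ∑ᴸ (filter P? (vectors m (upTo N))) (λ v → endWeight (c ∷ v)) ≈ total m (c ⊓ e)
    ∑-nested₂ {N = N} zero c e P? _ (_ , from) = begin
      ∑ᴸ (filter P? ([] ∷ [])) (λ v → endWeight (c ∷ v))
        ≡⟨ ≡.cong (λ vs → ∑ᴸ vs (λ v → endWeight (c ∷ v))) (filter-accept P? {[]} {[]} (from tt)) ⟩
      t * 1# + 0#
        ≈⟨ solve 2 (λ t k → t :* con 1 :+ con 0 := t :* (con 1 :+ k :* (t :* con 0))) refl t _ ⟩
      total 0 (c ⊓ e) ∎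
    ∑-nested₂ {N = suc N} (suc m) c e {P} P? c+m<N (to , from) = begin
      ∑ᴸ (filter P? (vectors (suc m) (upTo (suc N)))) (λ v → endWeight (c ∷ v))
        ≈⟨ ∑ᴸ-filter-product P? _∷_ (upTo (suc N)) vs (λ v → endWeight (c ∷ v)) ⟩
      ∑ᴸ (upTo (suc N)) inner
        ≡⟨ ∑ᴸ-upTo (suc N) inner ⟩
      ∑< (suc N) inner
        ≈⟨ ∑<-cong (suc N) inner≈ ⟩
      ∑< (suc N) (λ x → indicator (suc c) (total m (suc q)) x + jump x)
        ≈⟨ ∑<-+ (suc N) (indicator (suc c) (total m (suc q))) jump ⟩
      ∑< (suc N) (indicator (suc c) (total m (suc q))) + (t * total m 0 + ∑< N (below q (t * total m 1)))
        ≈⟨ +-cong (∑<-indicator (suc N) (suc c) _ (s≤s 1+c≤N))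
                  (+-congˡ (∑<-below N q _ (ℕ.≤-trans (ℕ.m⊓n≤m c e) (ℕ.<⇒≤ 1+c≤N)))) ⟩
      total m (suc q) + (t * total m 0 + fromℕ q * (t * total m 1))
        ≈⟨ total-suc m q ⟩
      total (suc m) q ∎
      where
      q = c ⊓ e
      vs = vectors m (upTo (suc N))
      -- An entry grows by at most one per vertex, so c + m bounds all entries to come; here this
      -- places c + 1 within the range of the sum.
      1+c+m≤N : suc c ℕ.+ m ≤ N
      1+c+m≤N = s≤s⁻¹ (≡.subst (_< suc N) (ℕ.+-suc c m) c+m<N)
      1+c≤N : suc c ≤ N
      1+c≤N = ℕ.≤-trans (ℕ.m≤m+n (suc c) m) 1+c+m≤N
      inner : ℕ → Carrier
      inner x = ∑ᴸ (filter (P? ∘ (x ∷_)) vs) (λ v → endWeight (c ∷ x ∷ v))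
      -- The state after a jump to x is (x , 1), with minimum 0 for x = 0 and 1 otherwise.
      jump : ℕ → Carrier
      jump zero    = t * total m 0
      jump (suc x) = below q (t * total m 1) x
      jump-≤ : ∀ x → x ≤ q → jump x ≈ t * total m (x ⊓ 1)
      jump-≤ zero    _   = refl
      jump-≤ (suc x) x<q = trans (below-< x<q)
        (reflexive (≡.cong (λ k → t * total m (suc k)) (≡.sym (ℕ.⊓-zeroʳ x))))
      jump-> : ∀ x → ¬ x ≤ q → jump x ≈ 0#
      jump-> zero    0≰q = contradiction z≤n 0≰q
      jump-> (suc x) x≮q = below-≥ (ℕ.≮⇒≥ x≮q)
      inner≈ : ∀ x → inner x ≈ indicator (suc c) (total m (suc q)) x + jump x
      inner≈ x with x ℕ.≟ suc c
      ... | yes ≡.refl = begin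
        inner (suc c)
          ≈⟨ ∑ᴸ-cong (filter (P? ∘ (suc c ∷_)) vs)
               (ListAll.universal (λ v → reflexive (≡.cong (t ^_) (ends-stay c (suc c) v ℕ.1+n≰n))) _) ⟩
        ∑ᴸ (filter (P? ∘ (suc c ∷_)) vs) (λ v → endWeight (suc c ∷ v))
          ≈⟨ ∑-nested₂ m (suc c) (suc e) (P? ∘ (suc c ∷_)) (s≤s 1+c+m≤N)
               ( (λ Pv → stay (to Pv)) , (λ N → from (inj₁ (≡.refl , N)))) ⟩
        total m (suc q)
          ≈⟨ +-identityʳ _ ⟨
        total m (suc q) + 0#
          ≈⟨ +-cong (indicator-≡ (suc c) _) (jump-> (suc c) (λ c<q → ℕ.<⇒≱ c<q (ℕ.m⊓n≤m c e))) ⟨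
        indicator (suc c) (total m (suc q)) (suc c) + jump (suc c) ∎
        where
        stay : ∀ {v} → Nested₂ e (c ∷ suc c ∷ v) → Nested₂ (suc e) (suc c ∷ v)
        stay (inj₁ (_ , N))       = N
        stay (inj₂ (1+c≤c , _ , _)) = contradiction 1+c≤c ℕ.1+n≰n
      ... | no x≢1+c with x ℕ.≤? q
      ...   | yes x≤q = begin
        inner x
          ≈⟨ ∑ᴸ-cong (filter (P? ∘ (x ∷_)) vs)
               (ListAll.universal (λ v → reflexive (≡.cong (t ^_) (ends-jump c x v x≤c))) _) ⟩
        ∑ᴸ (filter (P? ∘ (x ∷_)) vs) (λ v → t * endWeight (x ∷ v))
          ≈⟨ ∑ᴸ-*ˡ t (filter (P? ∘ (x ∷_)) vs) (λ v → endWeight (x ∷ v)) ⟩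
        t * ∑ᴸ (filter (P? ∘ (x ∷_)) vs) (λ v → endWeight (x ∷ v))
          ≈⟨ *-congˡ (∑-nested₂ m x 1 (P? ∘ (x ∷_))
               (ℕ.≤-<-trans (ℕ.+-monoˡ-≤ m x≤c) (ℕ.<⇒≤ (s≤s 1+c+m≤N)))
               ( (λ Pv → jumped (to Pv)) , (λ N → from (inj₂ (x≤c , x≤e , N))))) ⟩
        t * total m (x ⊓ 1)
          ≈⟨ jump-≤ x x≤q ⟨
        jump x
          ≈⟨ +-identityˡ _ ⟨
        0# + jump x
          ≈⟨ +-congʳ (indicator-≢ (suc c) _ x x≢1+c) ⟨
        indicator (suc c) (total m (suc q)) x + jump x ∎
        where
        x≤c = ℕ.≤-trans x≤q (ℕ.m⊓n≤m c e)
        x≤e = ℕ.≤-trans x≤q (ℕ.m⊓n≤n c e)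
        jumped : ∀ {v} → Nested₂ e (c ∷ x ∷ v) → Nested₂ 1 (x ∷ v)
        jumped (inj₁ (x≡1+c , _)) = contradiction x≡1+c x≢1+c
        jumped (inj₂ (_ , _ , N)) = N
      ...   | no x≰q = begin
        inner x
          ≡⟨ ≡.cong (λ vs → ∑ᴸ vs (λ v → endWeight (c ∷ x ∷ v)))
               (filter-none (P? ∘ (x ∷_)) (ListAll.universal (λ v Pv → impossible (to Pv)) vs)) ⟩
        0#
          ≈⟨ +-identityˡ 0# ⟨
        0# + 0#
          ≈⟨ +-cong (indicator-≢ (suc c) _ x x≢1+c) (jump-> x x≰q) ⟨
        indicator (suc c) (total m (suc q)) x + jump x ∎
        where
        impossible : ∀ {v} → ¬ Nested₂ e (c ∷ x ∷ v)
        impossible (inj₁ (x≡1+c , _))     = x≢1+c x≡1+c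
        impossible (inj₂ (x≤c , x≤e , _)) = x≰q (ℕ.⊓-glb x≤c x≤e)

    -- The first entry is 0, so the minimum in the state is 0 and the odd part drops out.
    ∑-rooted-nested₂ : ∀ m {P : Pred (Vec ℕ (suc m)) ℓp} (P? : Decidable P) →
      P ≐ (λ { (x ∷ v) → x ≡ 0 × Nested₂ 1 (x ∷ v) }) →
      ∑ᴸ (filter P? (vectors (suc m) (upTo (suc m)))) endWeight ≈ t * E m
    ∑-rooted-nested₂ m P? (to , from) = begin
      ∑ᴸ (filter P? (vectors (suc m) (upTo (suc m)))) endWeight
        ≈⟨ ∑ᴸ-filter-product P? _∷_ (upTo (suc m)) vs endWeight ⟩
      ∑ᴸ (upTo (suc m)) inner
        ≡⟨ ∑ᴸ-upTo (suc m) inner ⟩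
      ∑< (suc m) inner
        ≈⟨ ∑<-single (suc m) {inner} 0 z<s (λ x _ x≢0 → reflexive
             (≡.cong (λ vs → ∑ᴸ vs (λ v → endWeight (x ∷ v)))
             (filter-none (P? ∘ (x ∷_)) (ListAll.universal (λ v Pv → x≢0 (proj₁ (to Pv))) vs)))) ⟩
      inner 0
        ≈⟨ ∑-nested₂ m 0 1 (P? ∘ (0 ∷_)) (ℕ.n<1+n m)
             ((λ Pv → proj₂ (to Pv)) , (λ N → from (≡.refl , N))) ⟩
      total m 0
        ≈⟨ solve 3 (λ t e o → t :* (e :+ con 0 :* (t :* o)) := t :* e) refl t (E m) (O m) ⟩
      t * E m ∎
      where
      vs = vectors m (upTo (suc m))
      inner : ℕ → Carrier
      inner x = ∑ᴸ (filter (P? ∘ (x ∷_)) vs) (λ v → endWeight (x ∷ v))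

-- Motzkin paths of height at most 1 and Motzkin sequences with entries at most 2.

module MotzkinCounts where
  open ≡ using (refl; sym; trans; cong; cong₂; subst)
  open import Data.Nat.Base using (_+_; _*_)
  open import Defs
  open FilteredLists

  data Level₂ : Set where
    low high : Level₂

  -- Choose which of the m steps change the level; U and D then alternate. Ending low with i U steps
  -- takes 2i changes from `low` and 2i + 1 from `high`.
  binomial : Level₂ → ℕ → ℕ → ℕ
  binomial low  m i = m C (2 * i)
  binomial high m i = m C suc (2 * i)

  binomial-low-zero : ∀ m → binomial low (suc m) 0 ≡ binomial low m 0
  binomial-low-zero m = trans (nC0≡1 (suc m)) (sym (nC0≡1 m))

  binomial-low-suc : ∀ m i → binomial low (suc m) (suc i) ≡ binomial high m i + binomial low m (suc i)
  binomial-low-suc m i = begin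
    suc m C (2 * suc i)                           ≡⟨ cong (suc m C_) (ℕ.*-suc 2 i) ⟩
    suc m C suc (suc (2 * i))                     ≡⟨ nCk+nC[k+1]≡[n+1]C[k+1] m (suc (2 * i)) ⟨
    (m C suc (2 * i)) + (m C suc (suc (2 * i)))   ≡⟨ cong (λ k → (m C suc (2 * i)) + (m C k)) (ℕ.*-suc 2 i) ⟨
    (m C suc (2 * i)) + (m C (2 * suc i))         ∎
    where open ≡.≡-Reasoning

  binomial-high : ∀ m i → binomial high (suc m) i ≡ binomial low m i + binomial high m i
  binomial-high m i = sym (nCk+nC[k+1]≡[n+1]C[k+1] m (2 * i))

  -- A two-state automaton that merges nonnegativity, height at most 1 and return to the axis.
  BelowTwo : Level₂ → Vec Step m → Set
  BelowTwo low  []      = ⊤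
  BelowTwo low  (U ∷ p) = BelowTwo high p
  BelowTwo low  (D ∷ p) = ⊥
  BelowTwo low  (H ∷ p) = BelowTwo low p
  BelowTwo high []      = ⊥
  BelowTwo high (U ∷ p) = ⊥
  BelowTwo high (D ∷ p) = BelowTwo low p
  BelowTwo high (H ∷ p) = BelowTwo high p

  steps : List Step
  steps = U ∷ D ∷ H ∷ []

  -- P is only required to be equivalent to the condition, because the induction applies to
  -- `P? ∘ (s ∷_)`, the restriction of a given decision procedure to words beginning with s.
  length-belowTwo : ∀ y m i {P : Pred (Vec Step m) ℓp} (P? : Decidable P) →
    P ≐ (λ v → BelowTwo y v × upSteps v ≡ i) →
    length (filter P? (vectors m steps)) ≡ binomial y m i
  length-belowTwo low  zero zero    P? (to , from) = cong length (filter-accept P? {[]} {[]} (from (tt , refl)))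
  length-belowTwo low  zero (suc i) P? (to , from) =
    cong length (filter-reject P? {[]} {[]} (λ P[] → ℕ.0≢1+n (proj₂ (to P[]))))
  length-belowTwo high zero i       P? (to , from) = cong length (filter-reject P? {[]} {[]} (proj₁ ∘ to))
  length-belowTwo y (suc m) i P? (to , from) =
    trans (length-filter-vectors-∷ P? U (D ∷ H ∷ []) vs)
      (trans (cong (count U +_) (trans (length-filter-vectors-∷ P? D (H ∷ []) vs)
        (cong (count D +_) (trans (length-filter-vectors-∷ P? H [] vs) (ℕ.+-identityʳ (count H))))))
      (go y i P? (to , from)))
    where
    vs = vectors m steps
    count : Step → ℕ
    count s = length (filter (P? ∘ (s ∷_)) vs)
    go : ∀ y i {P : Pred (Vec Step (suc m)) ℓp} (P? : Decidable P) →
      P ≐ (λ v → BelowTwo y v × upSteps v ≡ i) →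
      length (filter (P? ∘ (U ∷_)) vs) + (length (filter (P? ∘ (D ∷_)) vs) + length (filter (P? ∘ (H ∷_)) vs))
        ≡ binomial y (suc m) i
    go low zero P? (to , from) = trans
      (cong₂ _+_ (length-filter-none (P? ∘ (U ∷_)) vs (λ v Pv → ℕ.1+n≢0 (proj₂ (to Pv))))
        (cong₂ _+_ (length-filter-none (P? ∘ (D ∷_)) vs (λ v Pv → proj₁ (to Pv)))
          (length-belowTwo low m zero (P? ∘ (H ∷_)) (to , from))))
      (sym (binomial-low-zero m))
    go low (suc i) P? (to , from) = trans
      (cong₂ _+_ (length-belowTwo high m i (P? ∘ (U ∷_))
          ((λ Pv → proj₁ (to Pv) , ℕ.suc-injective (proj₂ (to Pv))) , (λ (b , e) → from (b , cong suc e))))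
        (cong₂ _+_ (length-filter-none (P? ∘ (D ∷_)) vs (λ v Pv → proj₁ (to Pv)))
          (length-belowTwo low m (suc i) (P? ∘ (H ∷_)) (to , from))))
      (sym (binomial-low-suc m i))
    go high i P? (to , from) = trans
      (cong₂ _+_ (length-filter-none (P? ∘ (U ∷_)) vs (λ v Pv → proj₁ (to Pv)))
        (cong₂ _+_ (length-belowTwo low m i (P? ∘ (D ∷_)) (to , from))
          (length-belowTwo high m i (P? ∘ (H ∷_)) (to , from))))
      (sym (binomial-high m i))

  last-∷ : ∀ x (xs : Vec A (suc n)) → last (x ∷ xs) ≡ last xs
  last-∷ x xs with initLast xs
  ... | _ , _ , refl = refl

  ordinate : Level₂ → ℤ.ℤ
  ordinate low  = ℤ.0ℤ
  ordinate high = ℤ.1ℤ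

  Bounded : ℤ.ℤ → Vec Step m → Set
  Bounded y p = All (ℤ.0ℤ ℤ.≤_) (ordinates y p) × last (ordinates y p) ≡ ℤ.0ℤ
              × All (ℤ._≤ ℤ.1ℤ) (ordinates y p)

  bounded-∷⁺ : ∀ {y} s (p : Vec Step m) → ℤ.0ℤ ℤ.≤ y → y ℤ.≤ ℤ.1ℤ →
    Bounded (y ℤ.+ rise s) p → Bounded y (s ∷ p)
  bounded-∷⁺ {y = y} s p 0≤y y≤1 (0≤ , last≡0 , ≤1) =
    0≤y ∷ 0≤ , trans (last-∷ y (ordinates (y ℤ.+ rise s) p)) last≡0 , y≤1 ∷ ≤1

  bounded-∷⁻ : ∀ {y} s (p : Vec Step m) → Bounded y (s ∷ p) → Bounded (y ℤ.+ rise s) p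
  bounded-∷⁻ {y = y} s p (_ ∷ 0≤ , last≡0 , _ ∷ ≤1) =
    0≤ , trans (sym (last-∷ y (ordinates (y ℤ.+ rise s) p))) last≡0 , ≤1

  bounded-head : ∀ {y} (p : Vec Step m) → Bounded y p → ℤ.0ℤ ℤ.≤ y × y ℤ.≤ ℤ.1ℤ
  bounded-head []      (0≤y ∷ _ , _ , y≤1 ∷ _) = 0≤y , y≤1
  bounded-head (_ ∷ _) (0≤y ∷ _ , _ , y≤1 ∷ _) = 0≤y , y≤1

  0≤1 : ℤ.0ℤ ℤ.≤ ℤ.1ℤ
  0≤1 = ℤ.+≤+ z≤n

  belowTwo⇒bounded : ∀ y (p : Vec Step m) → BelowTwo y p → Bounded (ordinate y) p
  belowTwo⇒bounded low  []      b = ℤ.≤-refl ∷ [] , refl , 0≤1 ∷ []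
  belowTwo⇒bounded low  (U ∷ p) b = bounded-∷⁺ U p ℤ.≤-refl 0≤1 (belowTwo⇒bounded high p b)
  belowTwo⇒bounded low  (H ∷ p) b = bounded-∷⁺ H p ℤ.≤-refl 0≤1 (belowTwo⇒bounded low p b)
  belowTwo⇒bounded high (D ∷ p) b = bounded-∷⁺ D p 0≤1 ℤ.≤-refl (belowTwo⇒bounded low p b)
  belowTwo⇒bounded high (H ∷ p) b = bounded-∷⁺ H p 0≤1 ℤ.≤-refl (belowTwo⇒bounded high p b)

  bounded⇒belowTwo : ∀ y (p : Vec Step m) → Bounded (ordinate y) p → BelowTwo y p
  bounded⇒belowTwo low  []      b = tt
  bounded⇒belowTwo low  (U ∷ p) b = bounded⇒belowTwo high p (bounded-∷⁻ U p b)
  bounded⇒belowTwo low  (D ∷ p) b with () ← proj₁ (bounded-head p (bounded-∷⁻ D p b))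
  bounded⇒belowTwo low  (H ∷ p) b = bounded⇒belowTwo low p (bounded-∷⁻ H p b)
  bounded⇒belowTwo high []      (_ , () , _)
  bounded⇒belowTwo high (U ∷ p) b with ℤ.+≤+ (s≤s ()) ← proj₂ (bounded-head p (bounded-∷⁻ U p b))
  bounded⇒belowTwo high (D ∷ p) b = bounded⇒belowTwo low p (bounded-∷⁻ D p b)
  bounded⇒belowTwo high (H ∷ p) b = bounded⇒belowTwo high p (bounded-∷⁻ H p b)

  foldr-⊔≤⁺ : ∀ {z} (v : Vec ℤ.ℤ n) → ℤ.0ℤ ℤ.≤ z → All (ℤ._≤ z) v →
    foldr′ ℤ._⊔_ ℤ.0ℤ v ℤ.≤ z
  foldr-⊔≤⁺ []      0≤z []         = 0≤z
  foldr-⊔≤⁺ (x ∷ v) 0≤z (x≤z ∷ v≤) = ℤ.⊔-lub x≤z (foldr-⊔≤⁺ v 0≤z v≤)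

  foldr-⊔≤⁻ : ∀ {z} (v : Vec ℤ.ℤ n) → foldr′ ℤ._⊔_ ℤ.0ℤ v ℤ.≤ z → All (ℤ._≤ z) v
  foldr-⊔≤⁻ []      _ = []
  foldr-⊔≤⁻ (x ∷ v) h = ℤ.≤-trans (ℤ.i≤i⊔j x _) h ∷ foldr-⊔≤⁻ v (ℤ.≤-trans (ℤ.i≤j⊔i x _) h)

  length-motzkinPaths : ∀ m i {P : Pred (Vec Step m) ℓp} (P? : Decidable P) →
    P ≐ (λ p → upSteps p ≡ i × height p ℤ.≤ ℤ.1ℤ) →
    length (filter P? (motzkinPaths m)) ≡ m C (2 * i)
  length-motzkinPaths m i P? (to , from) = trans
    (cong length (filter-filter P? isMotzkinPath? S? id _,_ (vectors m steps)))
    (length-belowTwo low m i S?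
      ( (λ { {p} (Pp , 0≤ , last≡0) → let ups , h≤1 = to Pp in
             bounded⇒belowTwo low p (0≤ , last≡0 , foldr-⊔≤⁻ (ordinates ℤ.0ℤ p) h≤1) , ups })
      , (λ { {p} (b , ups) → let 0≤ , last≡0 , ≤1 = belowTwo⇒bounded low p b in
             from (ups , foldr-⊔≤⁺ (ordinates ℤ.0ℤ p) 0≤1 ≤1) , 0≤ , last≡0 })))
    where
    S? = λ p → P? p ×-dec isMotzkinPath? p

  entry : Level₂ → ℕ
  entry low  = 1
  entry high = 2

  OneOrTwo : ℕ → Set
  OneOrTwo x = 0 < x × x ≤ 2

  -- Letters 1 and 2 differ by at most one, so any choice of them ending in 1 is smooth; a letter is
  -- one more than the level of the corresponding path.
  OneTwoWord : Vec ℕ (suc m) → Set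
  OneTwoWord (x ∷ [])    = x ≡ 1
  OneTwoWord (x ∷ y ∷ w) = OneOrTwo x × OneTwoWord (y ∷ w)

  ascents-∷ : ∀ x y (w : Vec ℕ n) →
    ascents (x ∷ y ∷ w) ≡ length (filter (isAscent? (x ∷ y ∷ w)) (zero ∷ [])) + ascents (y ∷ w)
  ascents-∷ {n} x y w = trans (length-filter-allFin (isAscent? (x ∷ y ∷ w)))
    (cong (λ l → length (filter (isAscent? (x ∷ y ∷ w)) (zero ∷ [])) + length l)
      (filter-≐ (isAscent? (x ∷ y ∷ w) ∘ suc) (isAscent? (y ∷ w))
        ( (λ { (suc j , j≡ , <) → j , ℕ.suc-injective j≡ , < })
        , (λ { (j , j≡ , <) → suc j , cong suc j≡ , < })) (allFin (suc n))))

  ascents-up : ∀ x y (w : Vec ℕ n) → x < y → ascents (x ∷ y ∷ w) ≡ suc (ascents (y ∷ w))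
  ascents-up x y w x<y = trans (ascents-∷ x y w)
    (cong (λ l → length l + ascents (y ∷ w))
      (filter-accept (isAscent? (x ∷ y ∷ w)) {zero} {[]} (suc zero , refl , x<y)))

  ascents-flat : ∀ x y (w : Vec ℕ n) → ¬ x < y → ascents (x ∷ y ∷ w) ≡ ascents (y ∷ w)
  ascents-flat x y w x≮y = trans (ascents-∷ x y w)
    (cong (λ l → length l + ascents (y ∷ w))
      (filter-reject (isAscent? (x ∷ y ∷ w)) {zero} {[]} (λ { (suc zero , _ , x<y) → x≮y x<y })))

  ascents-singleton : ∀ x → ascents (x ∷ []) ≡ 0
  ascents-singleton x = cong length (filter-reject (isAscent? (x ∷ [])) {zero} {[]} (λ { (zero , () , _) }))

  oneTwoWord-head : ∀ x (w : Vec ℕ m) → OneTwoWord (x ∷ w) → OneOrTwo x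
  oneTwoWord-head x []      refl    = z<s , s≤s z≤n
  oneTwoWord-head x (_ ∷ _) (x≤2 , _) = x≤2

  oneOrTwo-entry : ∀ y → OneOrTwo (entry y)
  oneOrTwo-entry low  = z<s , s≤s z≤n
  oneOrTwo-entry high = z<s , s≤s (s≤s z≤n)

  -- The range is written 3 + N so that `upTo` unfolds to 0, 1, 2 and a remainder that contributes
  -- nothing.
  length-vectors-oneOrTwo : ∀ {m N} {P : Pred (Vec ℕ (suc m)) ℓp} (P? : Decidable P) →
    (∀ x v → P (x ∷ v) → OneOrTwo x) → (vs : List (Vec ℕ m)) →
    length (filter P? (cartesianProductWith _∷_ (upTo (3 + N)) vs)) ≡
    length (filter (P? ∘ (1 ∷_)) vs) + length (filter (P? ∘ (2 ∷_)) vs)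
  length-vectors-oneOrTwo {N = N} P? only vs =
    trans (length-filter-vectors-∷ P? 0 (1 ∷ 2 ∷ applyUpTo (3 +_) N) vs)
    (cong₂ _+_ (length-filter-none (P? ∘ (0 ∷_)) vs (λ v Pv → ℕ.n≮0 (proj₁ (only 0 v Pv))))
    (trans (length-filter-vectors-∷ P? 1 (2 ∷ applyUpTo (3 +_) N) vs)
    (cong (length (filter (P? ∘ (1 ∷_)) vs) +_)
    (trans (length-filter-vectors-∷ P? 2 (applyUpTo (3 +_) N) vs)
    (trans (cong (length (filter (P? ∘ (2 ∷_)) vs) +_)
      (length-filter-vectors-none P? (applyUpTo (3 +_) N) vs
        (ListAll.applyUpTo⁺₂ (3 +_) N (λ i v Pv →
          ℕ.<⇒≱ (s≤s (s≤s (s≤s z≤n))) (proj₂ (only (3 + i) v Pv))))))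
    (ℕ.+-identityʳ _))))))

  -- The same recursion as for paths, with ascents as U steps. The current letter stays outside the
  -- vector because an ascent compares it with the letter that follows.
  length-oneTwoWords : ∀ y m i {N} {P : Pred (Vec ℕ m) ℓp} (P? : Decidable P) →
    P ≐ (λ v → OneTwoWord (entry y ∷ v) × ascents (entry y ∷ v) ≡ i) →
    length (filter P? (vectors m (upTo (3 + N)))) ≡ binomial y m i
  length-oneTwoWords low  zero zero    P? (to , from) =
    cong length (filter-accept P? {[]} {[]} (from (refl , ascents-singleton 1)))
  length-oneTwoWords low  zero (suc i) P? (to , from) =
    cong length (filter-reject P? {[]} {[]} (λ P[] → ℕ.0≢1+n (trans (sym (ascents-singleton 1)) (proj₂ (to P[])))))
  length-oneTwoWords high zero i       P? (to , from) =
    cong length (filter-reject P? {[]} {[]} (λ P[] → ℕ.1+n≢0 (ℕ.suc-injective (proj₁ (to P[])))))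
  length-oneTwoWords y (suc m) i {N} P? (to , from) = trans
    (length-vectors-oneOrTwo {N = N} P? (λ x v Pv → oneTwoWord-head x v (proj₂ (proj₁ (to Pv)))) vs)
    (go y i P? (to , from))
    where
    vs = vectors m (upTo (3 + N))
    go : ∀ y i {P : Pred (Vec ℕ (suc m)) ℓp} (P? : Decidable P) →
      P ≐ (λ v → OneTwoWord (entry y ∷ v) × ascents (entry y ∷ v) ≡ i) →
      length (filter (P? ∘ (1 ∷_)) vs) + length (filter (P? ∘ (2 ∷_)) vs) ≡ binomial y (suc m) i
    flat : ∀ y y′ i {P : Pred (Vec ℕ (suc m)) ℓp} (P? : Decidable P) → ¬ entry y < entry y′ →
      P ≐ (λ v → OneTwoWord (entry y ∷ v) × ascents (entry y ∷ v) ≡ i) →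
      length (filter (P? ∘ (entry y′ ∷_)) vs) ≡ binomial y′ m i
    flat y y′ i P? ≮ (to , from) = length-oneTwoWords y′ m i {N} (P? ∘ (entry y′ ∷_))
      ( (λ {v} Pv → let (_ , w) , asc = to Pv in
          w , trans (sym (ascents-flat (entry y) (entry y′) v ≮)) asc)
      , (λ {v} (w , asc) → from ((oneOrTwo-entry y , w) , trans (ascents-flat (entry y) (entry y′) v ≮) asc)))
    go low zero P? P≐ = trans
      (cong₂ _+_ (flat low low zero P? (ℕ.<-irrefl refl) P≐)
        (length-filter-none (P? ∘ (2 ∷_)) vs (λ v Pv →
          ℕ.1+n≢0 (trans (sym (ascents-up 1 2 v (s≤s (s≤s z≤n)))) (proj₂ (proj₁ P≐ Pv))))))
      (trans (ℕ.+-identityʳ _) (sym (binomial-low-zero m)))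
    go low (suc i) P? P≐@(to , from) = trans
      (cong₂ _+_ (flat low low (suc i) P? (ℕ.<-irrefl refl) P≐)
        (length-oneTwoWords high m i {N} (P? ∘ (2 ∷_))
          ( (λ {v} Pv → let (_ , w) , asc = to Pv in
              w , ℕ.suc-injective (trans (sym (ascents-up 1 2 v (s≤s (s≤s z≤n)))) asc))
          , (λ {v} (w , asc) → from ((oneOrTwo-entry low , w) ,
              trans (ascents-up 1 2 v (s≤s (s≤s z≤n))) (cong suc asc))))))
      (trans (ℕ.+-comm (binomial low m (suc i)) _) (sym (binomial-low-suc m i)))
    go high i P? P≐ = trans
      (cong₂ _+_ (flat high low i P? (λ { (s≤s ()) }) P≐) (flat high high i P? (ℕ.<-irrefl refl) P≐))
      (sym (binomial-high m i))

  RootedWord : Vec ℕ (suc m) → Set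
  RootedWord w = head w ≡ 1 × OneTwoWord w

  oneTwoWord : (w : Vec ℕ (suc m)) → (∀ i → OneOrTwo (lookup w i)) →
    (∀ i → toℕ i ≡ m → lookup w i ≡ 1) → OneTwoWord w
  oneTwoWord (x ∷ [])    _     end = end zero refl
  oneTwoWord (x ∷ y ∷ w) entries end =
    entries zero , oneTwoWord (y ∷ w) (entries ∘ suc) (λ i e → end (suc i) (cong suc e))

  oneTwoWord-lookup : (w : Vec ℕ (suc m)) → OneTwoWord w → ∀ i → OneOrTwo (lookup w i)
  oneTwoWord-lookup (x ∷ w)     ok       zero    = oneTwoWord-head x w ok
  oneTwoWord-lookup (x ∷ y ∷ w) (_ , ok) (suc i) = oneTwoWord-lookup (y ∷ w) ok i

  oneTwoWord-last : (w : Vec ℕ (suc m)) → OneTwoWord w → ∀ i → toℕ i ≡ m → lookup w i ≡ 1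
  oneTwoWord-last (x ∷ [])    ok       zero    _ = ok
  oneTwoWord-last (x ∷ y ∷ w) (_ , ok) (suc i) e = oneTwoWord-last (y ∷ w) ok i (ℕ.suc-injective e)

  oneOrTwo-smooth : ∀ {x y} → OneOrTwo x → OneOrTwo y → ∣ x - y ∣ ≤ 1
  oneOrTwo-smooth {1} {1} _ _ = z≤n
  oneOrTwo-smooth {1} {2} _ _ = s≤s z≤n
  oneOrTwo-smooth {2} {1} _ _ = s≤s z≤n
  oneOrTwo-smooth {2} {2} _ _ = z≤n
  oneOrTwo-smooth {suc (suc (suc _))} (_ , s≤s (s≤s ())) _
  oneOrTwo-smooth {1} {suc (suc (suc _))} _ (_ , s≤s (s≤s ()))
  oneOrTwo-smooth {2} {suc (suc (suc _))} _ (_ , s≤s (s≤s ()))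

  toList-lookup : {P : Pred A ℓp} (v : Vec A n) → ListAll.All P (toList v) → ∀ i → P (lookup v i)
  toList-lookup (x ∷ v) (px ∷ _)  zero    = px
  toList-lookup (x ∷ v) (_ ∷ pxs) (suc i) = toList-lookup v pxs i

  toList-lookup⁻ : {P : Pred A ℓp} (v : Vec A n) → (∀ i → P (lookup v i)) → ListAll.All P (toList v)
  toList-lookup⁻ []      _   = []
  toList-lookup⁻ (x ∷ v) pxs = pxs zero ∷ toList-lookup⁻ v (pxs ∘ suc)

  motzkin⇒rootedWord : (w : Vec ℕ (suc m)) → IsMotzkinSequence w → largestEntry w ≤ 2 → RootedWord w
  motzkin⇒rootedWord w@(_ ∷ _) (positive , start , end , _) ≤2 =
      start zero refl
    , oneTwoWord w (λ i → positive i , ℕ.≤-trans (toList-lookup w (xs≤max 0 (toList w)) i) ≤2)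
        (λ i e → end i (cong suc e))

  rootedWord⇒motzkin : (w : Vec ℕ (suc m)) → RootedWord w → IsMotzkinSequence w × largestEntry w ≤ 2
  rootedWord⇒motzkin w@(_ ∷ _) (start , ok) =
    ( (λ i → proj₁ (entries i))
    , (λ { zero _ → start })
    , (λ i e → oneTwoWord-last w ok i (ℕ.suc-injective e))
    , (λ i j _ → oneOrTwo-smooth (entries i) (entries j)))
    , max≤v⁺ z≤n (toList-lookup⁻ w (λ i → proj₂ (entries i)))
    where entries = oneTwoWord-lookup w ok

  length-motzkinSequences : ∀ m i {P : Pred (Vec ℕ (suc m)) ℓp} (P? : Decidable P) →
    P ≐ (λ w → ascents w ≡ i × largestEntry w ≤ 2) →
    length (filter P? (motzkinSequences (suc m))) ≡ m C (2 * i)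
  length-motzkinSequences m i P? (to , from) = trans
    (cong length (filter-filter P? isMotzkinSequence? S? id _,_ (vectors (suc m) (upTo (2 + m)))))
    (rooted m S?
      ( (λ { {w} (Pw , motzkin) → let asc , ≤2 = to Pw in motzkin⇒rootedWord w motzkin ≤2 , asc })
      , (λ { {w} (word , asc) → let motzkin , ≤2 = rootedWord⇒motzkin w word in from (asc , ≤2) , motzkin })))
    where
    S? = λ w → P? w ×-dec isMotzkinSequence? w
    rooted : ∀ m {Q : Pred (Vec ℕ (suc m)) ℓp} (Q? : Decidable Q) →
      Q ≐ (λ w → RootedWord w × ascents w ≡ i) →
      length (filter Q? (vectors (suc m) (upTo (2 + m)))) ≡ m C (2 * i)
    -- For size 1 the letters come from `upTo 2`, which is too short for `length-vectors-oneOrTwo`.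
    rooted zero Q? (to , from) = trans (length-filter-vectors-∷ Q? 0 (1 ∷ []) ([] ∷ []))
      (cong₂ _+_ (length-filter-none (Q? ∘ (0 ∷_)) ([] ∷ []) (λ v Qv → ℕ.0≢1+n (proj₁ (proj₁ (to Qv)))))
        (trans (length-filter-vectors-∷ Q? 1 [] ([] ∷ []))
          (trans (ℕ.+-identityʳ _) (length-oneTwoWords low zero i {0} (Q? ∘ (1 ∷_))
            ( (λ Qv → proj₂ (proj₁ (to Qv)) , proj₂ (to Qv)) , (λ (w , asc) → from ((refl , w) , asc)))))))
    rooted (suc m) Q? (to , from) = trans
      (length-vectors-oneOrTwo {N = m} Q?
        (λ x v Qv → oneTwoWord-head x v (proj₂ (proj₁ (to Qv)))) (vectors (suc m) (upTo (3 + m))))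
      (trans (cong₂ _+_
        (length-oneTwoWords low (suc m) i {m} (Q? ∘ (1 ∷_))
          ( (λ Qv → proj₂ (proj₁ (to Qv)) , proj₂ (to Qv)) , (λ (w , asc) → from ((refl , w) , asc))))
        (length-filter-none (Q? ∘ (2 ∷_)) (vectors (suc m) (upTo (3 + m)))
          (λ v Qv → ℕ.1+n≢0 (ℕ.suc-injective (proj₁ (proj₁ (to Qv)))))))
        (ℕ.+-identityʳ _))

-- The theorem over the rationals.

open import Data.Integer.Base using (+_)
open import Data.Nat.Base using (_*_)
open import Defs

ℚ[X] : CommutativeRing _ _
ℚ[X] = PolynomialRing.polynomialRing ℚ.+-*-commutativeRing

open EvenOddParts ℚ[X] using (even)

peakPolynomial-𝒩₂ : ∀ m →
  PeakPolynomial (𝒩 2 (suc m)) ≈ᵖ X *ᵖ even (1ᵖ +ᵖ X) X m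
peakPolynomial-𝒩₂ m k = ≡.trans
  (≡.cong (λ as → coeff (PeakPolynomial as) k)
    (filter-filter (λ a → pnest a ℕ.≤? 2) isAreaSequence? S? id _,_ (vectors (suc m) (upTo (suc m)))))
  (≡.trans
    (∑ᴸ-cong (filter S? (vectors (suc m) (upTo (suc m)))) {λ a → X ^ peak a} {λ a → X ^ ends a}
      (ListAll.map (λ {a} (_ , isArea) j → ≡.cong (λ e → coeff (X ^ e) j) (AreaSequence.peak≡ends a isArea))
        (ListAll.all-filter S? (vectors (suc m) (upTo (suc m))))) k)
    (∑-rooted-nested₂ X m S?
      ( (λ { {x ∷ v} (pnest≤2 , isArea) → 𝒩₂⇒nested₂ (x ∷ v) isArea pnest≤2 })
      , (λ { {x ∷ v} (x≡0 , nested) →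
            let isArea , pnest≤2 = nested₂⇒𝒩₂ (x ∷ v) x≡0 nested in pnest≤2 , isArea }))
      k))
  where
  open FilteredLists using (filter-filter)
  open CliquesOfAreaSequences
  open WeightedSums ℚ[X]
  open Sums ℚ[X] using (∑ᴸ-cong)
  S? : Decidable (λ (a : Vec ℕ (suc m)) → pnest a ≤ 2 × IsAreaSequence a)
  S? a = (pnest a ℕ.≤? 2) ×-dec isAreaSequence? a

proposition5p10 : ∀ (n : ℕ) → 1 ≤ n →
    (∃[ p ] PeakPolynomial (𝒩 2 n) ≈ᵖ X *ᵖ p × IsGammaPolynomial p (evenBinomialSum (n ∸ 1)))
    × (evenBinomialSum (n ∸ 1) ⟨ X ^ 2 ⟩ ≈ᵖ ½ · ((1ᵖ +ᵖ X) ^ (n ∸ 1) +ᵖ (1ᵖ -ᵖ X) ^ (n ∸ 1)))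
    × (∀ (i : ℕ) →
    (length (filter (λ p → (upSteps p ℕ.≟ i) ×-dec (height p ℤ.≤? + 1)) (motzkinPaths (n ∸ 1))) ≡ (n ∸ 1) C (2 * i))
    × (length (filter (λ w → (ascents w ℕ.≟ i) ×-dec (largestEntry w ℕ.≤? 2)) (motzkinSequences n)) ≡ (n ∸ 1) C (2 * i)))
proposition5p10 (suc m) _ =
    -- In the rationals 1 ≉ 0 and ½ + ½ ≈ 1 hold by evaluation, which is what `λ ()` and `≡.refl`
    -- stand for.
    (even (1ᵖ +ᵖ X) X m , peakPolynomial-𝒩₂ m , even-isGammaPolynomial (λ ()) m)
  , evenBinomials-X² ≡.refl m
  , (λ i → length-motzkinPaths m i (λ p → (upSteps p ℕ.≟ i) ×-dec (height p ℤ.≤? + 1)) (id , id)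
         , length-motzkinSequences m i (λ w → (ascents w ℕ.≟ i) ×-dec (largestEntry w ℕ.≤? 2)) (id , id))
  where
  open PolynomialIdentities ℚ.+-*-commutativeRing
  open MotzkinCounts
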